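{- Let $q=q_1q_2\cdots q_k$ be a fixed permutation pattern of length $k$. For $n>k$, let $X_n$ be the number of occurrences (copies) of $q$ in a permutation of length $n$ chosen uniformly at random. Then there exists a positive constant $c$ such that for all $n>k$, the inequality $$\operatorname{Var}(X_n)\geq c\,n^{2k-1}$$ holds.
   Context: A permutation of length $n$ is written in one-line notation $p=p_1p_2\cdots p_n$ and is selected at random with each of the $n!$ permutations having probability $1/n!$. A permutation pattern of length $k$ is a permutation $q=q_1\cdots q_k$. An occurrence (copy) of $q$ in $p$ is a set of positions $1\leq i_1<i_2<\cdots<i_k\leq n$ (not necessarily consecutive) such that for all indices $j$ and $r$, $q_j<q_r$ if and only if $p_{i_j}<p_{i_r}$. Equivalently, $X_n=\sum_{i=1}^{\binom{n}{k}}X_{n,i}$, where the $k$-element subsets of positions are listed in some order and $X_{n,i}$ is the indicator variable of the event that the entries in the $i$th such subset form a copy of $q$. The pattern $q$ (and hence $k$) is fixed, and the constant $c$ does not depend on $n$.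
   Formalization: The pattern length k is assumed to be at least 2; for k = 1 the number of copies X_n = n is constant, so Var(X_n) = 0 and the inequality fails for every positive c. -}

module Defs where

open import Data.Fin as Fin using (Fin; zero; suc; punchIn)
open import Data.Fin.Permutation as Perm
  using (Permutation′; _⟨$⟩ʳ_; insert; remove; insert-remove)
open import Data.Fin.Properties using (all?; punchIn-injective; _<?_)
open import Data.Integer using (+_)
open import Data.List using (List; []; _∷_; [_]; map; filter; length; foldr; allFin; cartesianProductWith)
open import Data.List.Membership.Propositional using (_∈_)
open import Data.List.Membership.Propositional.Properties using (∈-allFin; ∈-cartesianProductWith⁺)
open import Data.List.Properties using (length-++; length-map; length-tabulate)
open import Data.List.Relation.Unary.All using ([])
open import Data.List.Relation.Unary.AllPairs using ([]; _∷_)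
open import Data.List.Relation.Unary.Any using (Any; here)
open import Data.List.Relation.Unary.Any.Properties using (cartesianProductWith⁺)
import Data.List.Relation.Unary.Unique.Propositional as Uniqueₚ
import Data.List.Relation.Unary.Unique.Propositional.Properties as Uniqueₚ
import Data.List.Relation.Unary.Unique.Setoid as Uniqueₛ
import Data.List.Relation.Unary.Unique.Setoid.Properties as Uniqueₛ
open import Data.Nat as ℕ using (ℕ; zero; suc; _!)
open import Data.Nat.Properties using (_!≢0)
open import Data.Product using (_×_; _,_)
open import Data.Rational using (ℚ; 0ℚ; _/_; _+_; _*_; _-_)
open import Data.Vec using (Vec; []; _∷_; lookup)
open import Data.Vec.Properties using (∷-injective)
open import Function.Bundles using (_⇔_; mk⇔; Equivalence)
open import Relation.Binary.Bundles using (Setoid)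
open import Relation.Binary.PropositionalEquality
  using (_≡_; refl; sym; trans; cong; cong₂; setoid)
open import Relation.Nullary.Decidable using (Dec; _×-dec_; _→-dec_; map′)
open import Relation.Unary using (Decidable)

-- One-line notation is 0-based: the entry p_{i+1} of p is p ⟨$⟩ʳ i.

permutations : ∀ n → List (Permutation′ n)
permutations zero    = [ Perm.id ]
permutations (suc n) = cartesianProductWith (insert zero) (allFin (suc n)) (permutations n)

tuples : ∀ k n → List (Vec (Fin n) k)
tuples zero    n = [ [] ]
tuples (suc k) n = cartesianProductWith _∷_ (allFin n) (tuples k n)

-- A set of k positions i₁ < ⋯ < iₖ is represented by the increasing tuple
-- of its elements.
Increasing : ∀ {k n} → Vec (Fin n) k → Set
Increasing {k} is = ∀ (j r : Fin k) → j Fin.< r → lookup is j Fin.< lookup is r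

SameOrder : ∀ {k n} → Permutation′ k → Permutation′ n → Vec (Fin n) k → Set
SameOrder {k} q p is = ∀ (j r : Fin k) →
  (q ⟨$⟩ʳ j) Fin.< (q ⟨$⟩ʳ r) ⇔ (p ⟨$⟩ʳ lookup is j) Fin.< (p ⟨$⟩ʳ lookup is r)

IsOccurrence : ∀ {k n} → Permutation′ k → Permutation′ n → Vec (Fin n) k → Set
IsOccurrence q p is = Increasing is × SameOrder q p is

isOccurrence? : ∀ {k n} (q : Permutation′ k) (p : Permutation′ n) → Decidable (IsOccurrence q p)
isOccurrence? q p is = increasing? ×-dec sameOrder?
  where
  increasing? : Dec (Increasing is)
  increasing? = all? λ j → all? λ r → (j <? r) →-dec (lookup is j <? lookup is r)

  _⇔-dec_ : ∀ {A B : Set} → Dec A → Dec B → Dec (A ⇔ B)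
  A? ⇔-dec B? = map′ (λ (f , g) → mk⇔ f g) (λ e → Equivalence.to e , Equivalence.from e)
    ((A? →-dec B?) ×-dec (B? →-dec A?))

  sameOrder? : Dec (SameOrder q p is)
  sameOrder? = all? λ j → all? λ r →
    ((q ⟨$⟩ʳ j) <? (q ⟨$⟩ʳ r)) ⇔-dec ((p ⟨$⟩ʳ lookup is j) <? (p ⟨$⟩ʳ lookup is r))

occurrences : ∀ {k n} → Permutation′ k → Permutation′ n → ℕ
occurrences {k} {n} q p = length (filter (isOccurrence? q p) (tuples k n))

fromℕ : ℕ → ℚ
fromℕ m = + m / 1

X : ∀ {k} → Permutation′ k → ∀ n → Permutation′ n → ℚ
X q n p = fromℕ (occurrences q p)

sumℚ : List ℚ → ℚ
sumℚ = foldr _+_ 0ℚ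

-- Expectation and variance for the uniform distribution on the n!
-- permutations of length n.

𝔼 : ∀ {n} → (Permutation′ n → ℚ) → ℚ
𝔼 {n} Y = (+ 1 / (n !)) * sumℚ (map Y (permutations n))
  where instance _ = n !≢0

Var : ∀ {n} → (Permutation′ n → ℚ) → ℚ
Var Y = 𝔼 λ p → (Y p - 𝔼 Y) * (Y p - 𝔼 Y)

-- The enumerations list every element exactly once.  Permutations are
-- compared pointwise, by Perm._≈_.

≈-setoid : ℕ → Setoid _ _
≈-setoid n = record
  { Carrier       = Permutation′ n
  ; _≈_           = Perm._≈_
  ; isEquivalence = record
    { refl  = λ _ → refl
    ; sym   = λ e i → sym (e i)
    ; trans = λ e f i → trans (e i) (f i)
    }
  }

insert-cong : ∀ {n} {i j : Fin (suc n)} {π ρ : Permutation′ n} →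
              i ≡ j → π Perm.≈ ρ → insert zero i π Perm.≈ insert zero j ρ
insert-cong refl e zero    = refl
insert-cong {i = i} refl e (suc l) = cong (punchIn i) (e l)

insert-injective : ∀ {n} {i j : Fin (suc n)} {π ρ : Permutation′ n} →
                   insert zero i π Perm.≈ insert zero j ρ → i ≡ j × π Perm.≈ ρ
insert-injective {i = i} e with refl ← e zero =
  refl , λ l → punchIn-injective i _ _ (e (suc l))

permutations-complete : ∀ {n} (π : Permutation′ n) → Any (π Perm.≈_) (permutations n)
permutations-complete {zero}  π = here λ ()
permutations-complete {suc n} π = cartesianProductWith⁺ (insert zero)
  (λ {i} {ρ} i≡ e l → trans (sym (insert-remove zero π l))
    (insert-cong {π = remove zero π} {ρ = ρ} i≡ e l))
  (∈-allFin (π ⟨$⟩ʳ zero))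
  (permutations-complete (remove zero π))

permutations-unique : ∀ n → Uniqueₛ.Unique (≈-setoid n) (permutations n)
permutations-unique zero    = [] ∷ []
permutations-unique (suc n) =
  Uniqueₛ.cartesianProductWith⁺ (setoid _) (≈-setoid n) (≈-setoid (suc n))
    (insert zero) (λ {_} {_} {π} {ρ} → insert-injective {π = π} {ρ = ρ})
    (Uniqueₚ.allFin⁺ (suc n)) (permutations-unique n)

length-cartesianProductWith : ∀ {A B C : Set} (f : A → B → C) xs ys →
  length (cartesianProductWith f xs ys) ≡ length xs ℕ.* length ys
length-cartesianProductWith f []       ys = refl
length-cartesianProductWith f (x ∷ xs) ys = trans (length-++ (map (f x) ys))
  (cong₂ ℕ._+_ (length-map (f x) ys) (length-cartesianProductWith f xs ys))

length-permutations : ∀ n → length (permutations n) ≡ n !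
length-permutations zero    = refl
length-permutations (suc n) =
  trans (length-cartesianProductWith (insert zero) (allFin (suc n)) (permutations n))
    (cong₂ ℕ._*_ (length-tabulate {n = suc n} (λ i → i)) (length-permutations n))

tuples-complete : ∀ {k n} (is : Vec (Fin n) k) → is ∈ tuples k n
tuples-complete []       = here refl
tuples-complete (i ∷ is) = ∈-cartesianProductWith⁺ _∷_ (∈-allFin i) (tuples-complete is)

tuples-unique : ∀ k n → Uniqueₚ.Unique (tuples k n)
tuples-unique zero    n = [] ∷ []
tuples-unique (suc k) n = Uniqueₚ.cartesianProductWith⁺ _∷_ ∷-injective
  (Uniqueₚ.allFin⁺ n) (tuples-unique k n)

{-# OPTIONS --safe #-}
-- For any statistic Z with mean 0 and any s, Var X ≥ 2s 𝔼[XZ] − s² 𝔼[Z²], so it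
-- suffices to find a Z correlated with X.  Take Z(p) = Σᵢ a(i) a(pᵢ) for a weight
-- a = aₙ on the n positions that sums to 0 and has the property that the average
-- of aₙ over the j-th smallest elements of the k-subsets of positions is exactly
-- aₖ(j).  Such weights are aₙ(i) = C(n − 1 − i + L, L) / C(n + L, L) − 1 / (L + 1),
-- for each L.  Then
--   𝔼[XZ] = C(n, k) d / k!   with   d = Σⱼ aₖ(j) aₖ(qⱼ),
-- and 𝔼[Z²] = (Σ aₙ²)² / (n − 1) ≤ 2n; choosing s proportional to C(n, k) / n gives
-- Var X ≥ d² C(n, k)² / (2 k!² n).  Finally d ≠ 0 for L = k³: the value of aₖ + 1 / (L + 1)
-- at the first position dominates the others, so that d is positive if q
-- starts with its least entry and negative otherwise.
module Submission where

open import Defs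
open import Data.Nat using (ℕ; _≤_; _<_; _∸_; _^_) renaming (_*_ to _*ℕ_)
open import Data.Rational using (ℚ; 0ℚ; _*_) renaming (_<_ to _<ℚ_; _≥_ to _≥ℚ_)
open import Data.Fin.Permutation using (Permutation′)
open import Data.Product using (Σ-syntax; _×_)

open import Algebra.Bundles using (CommutativeRing)
import Algebra.Properties.Semiring.Sum as SemiringSum
open import Data.Fin as Fin using (Fin; zero; suc; punchIn; punchOut)
open import Data.Fin.Permutation as Perm
  using (_⟨$⟩ʳ_; _⟨$⟩ˡ_; insert; remove; insert-remove; insert-punchIn; inverseʳ; inverseˡ)
open import Data.Fin.Properties as Finₚ
  using (punchIn-injective; punchInᵢ≢i; punchIn-punchOut; punchOut-injective)
import Data.Integer as ℤ
import Data.Integer.Properties as ℤₚ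
open import Data.List
  using (List; []; _∷_; [_]; map; filter; length; allFin; tabulate; _++_; cartesianProductWith)
open import Data.List.Membership.Propositional using (_∈_; _∉_)
open import Data.List.Membership.Propositional.Properties
  using (∈-allFin; ∈-map⁺; ∈-map⁻; ∈-++⁺ˡ; ∈-++⁺ʳ; ∈-++⁻; ∈-filter⁺; ∈-filter⁻)
open import Data.List.Membership.Propositional.Properties.WithK using (unique∧set⇒bag)
open import Data.List.Properties using (map-∘; length-++; length-map)
open import Data.List.Relation.Binary.BagAndSetEquality using (∼bag⇒↭)
open import Data.List.Relation.Binary.Permutation.Propositional using (_↭_; ↭⇒↭ₛ)
import Data.List.Relation.Binary.Permutation.Propositional.Properties as ↭ₚ
open import Data.List.Relation.Binary.Permutation.Setoid.Properties using (foldr-commMonoid)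
open import Data.List.Relation.Unary.All as All using ([])
open import Data.List.Relation.Unary.AllPairs using ([]; _∷_)
open import Data.List.Relation.Unary.Any as Any using (Any; here; there)
open import Data.List.Relation.Unary.Any.Properties as Anyₚ using (cartesianProductWith⁺)
open import Data.List.Relation.Unary.Unique.Propositional using (Unique)
import Data.List.Relation.Unary.Unique.Propositional.Properties as Uniqueₚ
import Data.List.Relation.Unary.Unique.Setoid as Uniqueₛ
import Data.List.Relation.Unary.Unique.Setoid.Properties as Uniqueₛₚ
open import Data.Nat as ℕ using (zero; suc; _!)
import Data.Nat.Properties as ℕₚ
open import Data.Nat.Tactic.RingSolver using (solve-∀)
open import Data.Product using (∃; _,_; proj₁)
open import Data.Rational
  using (1ℚ; _+_; _-_; -_; _/_; toℚᵘ; nonNegative; positive) renaming (_≤_ to _≤ℚ_)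
open import Data.Rational.Properties as ℚₚ using (+-*-commutativeRing)
open import Data.Rational.Solver using (module +-*-Solver)
import Data.Rational.Unnormalised as ℚᵘ
import Data.Rational.Unnormalised.Properties as ℚᵘₚ
open import Data.Sum using (inj₁; inj₂)
open import Data.Vec as Vec using (Vec; []; _∷_; lookup)
import Data.Vec.Properties as Vecₚ
open import Function using (_∘_; id)
open import Function.Bundles using (mk⇔; module Equivalence)
open import Relation.Binary.Definitions using (DecidableEquality; tri<; tri≈; tri>)
open import Relation.Binary.PropositionalEquality hiding ([_]; J)
open import Relation.Nullary using (Dec; yes; no; ¬_; contradiction)
open import Relation.Unary using (Decidable)

open SemiringSum (CommutativeRing.semiring +-*-commutativeRing)
  using (sum; sum-remove; sum-permute; sum-cong-≗; sum-replicate-zero;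
         ∑-distrib-+; *-distribˡ-sum; *-distribʳ-sum)
open ≡-Reasoning
open +-*-Solver using (solve; _:+_; _:*_; _:-_; :-_; _:=_; con)

-- Finite sums of rational numbers

-- The weights come from order statistics: aₙ(i) + 1 / (L + 1) is the mean of (1 - U)^L, where U is
-- the (i + 1)-st smallest of n independent uniform points of [0, 1]. A random k-subset of n such
-- points is again k uniform points, so averaging over k-subsets must turn aₙ into aₖ; and 1 / (L +
-- 1) is the mean for a single uniform point. No fixed L serves all patterns: for L = 1 the weights
-- are linear and d is proportional to the covariance of j and q_j, which vanishes for 2413. For k
-- fixed and L large, the square of the first value is about k² / L² and exceeds k / (L + 1)², while
-- a product of two values that are not both the first is of order 1 / L³. The obstacle in 𝔼[XZ] is
-- that an occurrence is an order condition. Splitting it by the set of values that the copy uses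
-- turns it into equations p(i_j) = u_{q_j}, and positions and values then range over k-subsets
-- independently. The averaging property can therefore be applied twice, once to the positions and
-- once to the values.

fromℕ-homo-+ : ∀ m n → fromℕ (m ℕ.+ n) ≡ fromℕ m + fromℕ n
fromℕ-homo-+ m n = ℚₚ.toℚᵘ-injective (begin-≃
  toℚᵘ (fromℕ (m ℕ.+ n))           ≈⟨ ℚₚ.toℚᵘ-fromℚᵘ (ℚᵘ.mkℚᵘ (ℤ.+ (m ℕ.+ n)) 0) ⟩
  ℚᵘ.mkℚᵘ (ℤ.+ (m ℕ.+ n)) 0          ≈⟨ ℚᵘ.*≡* (cong (ℤ._* ℤ.+ 1) (sym (cong₂ ℤ._+_ (ℤₚ.*-identityʳ (ℤ.+ m)) (ℤₚ.*-identityʳ (ℤ.+ n))))) ⟩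
  ℚᵘ.mkℚᵘ (ℤ.+ m) 0 ℚᵘ.+ ℚᵘ.mkℚᵘ (ℤ.+ n) 0
    ≈⟨ ℚᵘₚ.+-cong (ℚₚ.toℚᵘ-fromℚᵘ (ℚᵘ.mkℚᵘ (ℤ.+ m) 0)) (ℚₚ.toℚᵘ-fromℚᵘ (ℚᵘ.mkℚᵘ (ℤ.+ n) 0)) ⟨
  toℚᵘ (fromℕ m) ℚᵘ.+ toℚᵘ (fromℕ n) ≈⟨ ℚₚ.toℚᵘ-homo-+ (fromℕ m) (fromℕ n) ⟨
  toℚᵘ (fromℕ m + fromℕ n)         ≃∎)
  where open ℚᵘₚ.≃-Reasoning renaming (begin_ to begin-≃_; _∎ to _≃∎)

fromℕ-homo-* : ∀ m n → fromℕ (m ℕ.* n) ≡ fromℕ m * fromℕ n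
fromℕ-homo-* m n = ℚₚ.toℚᵘ-injective (begin-≃
  toℚᵘ (fromℕ (m ℕ.* n))           ≈⟨ ℚₚ.toℚᵘ-fromℚᵘ (ℚᵘ.mkℚᵘ (ℤ.+ (m ℕ.* n)) 0) ⟩
  ℚᵘ.mkℚᵘ (ℤ.+ (m ℕ.* n)) 0          ≈⟨ ℚᵘ.*≡* (cong (ℤ._* ℤ.+ 1) (ℤₚ.pos-* m n)) ⟩
  ℚᵘ.mkℚᵘ (ℤ.+ m) 0 ℚᵘ.* ℚᵘ.mkℚᵘ (ℤ.+ n) 0
    ≈⟨ ℚᵘₚ.*-cong (ℚₚ.toℚᵘ-fromℚᵘ (ℚᵘ.mkℚᵘ (ℤ.+ m) 0)) (ℚₚ.toℚᵘ-fromℚᵘ (ℚᵘ.mkℚᵘ (ℤ.+ n) 0)) ⟨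
  toℚᵘ (fromℕ m) ℚᵘ.* toℚᵘ (fromℕ n) ≈⟨ ℚₚ.toℚᵘ-homo-* (fromℕ m) (fromℕ n) ⟨
  toℚᵘ (fromℕ m * fromℕ n)         ≃∎)
  where open ℚᵘₚ.≃-Reasoning renaming (begin_ to begin-≃_; _∎ to _≃∎)

1/n*n≡1 : ∀ n .{{_ : ℕ.NonZero n}} → (ℤ.+ 1 / n) * fromℕ n ≡ 1ℚ
1/n*n≡1 n@(suc m) = ℚₚ.toℚᵘ-injective (begin-≃
  toℚᵘ ((ℤ.+ 1 / n) * fromℕ n)         ≈⟨ ℚₚ.toℚᵘ-homo-* (ℤ.+ 1 / n) (fromℕ n) ⟩
  toℚᵘ (ℤ.+ 1 / n) ℚᵘ.* toℚᵘ (fromℕ n)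
    ≈⟨ ℚᵘₚ.*-cong (ℚₚ.toℚᵘ-fromℚᵘ (ℚᵘ.mkℚᵘ (ℤ.+ 1) m)) (ℚₚ.toℚᵘ-fromℚᵘ (ℚᵘ.mkℚᵘ (ℤ.+ n) 0)) ⟩
  ℚᵘ.mkℚᵘ (ℤ.+ 1) m ℚᵘ.* ℚᵘ.mkℚᵘ (ℤ.+ n) 0 ≈⟨ ℚᵘ.*≡* (cong ℤ.+_ lem) ⟩
  toℚᵘ 1ℚ ≃∎)
  where
  open ℚᵘₚ.≃-Reasoning renaming (begin_ to begin-≃_; _∎ to _≃∎)
  lem : (1 ℕ.* n) ℕ.* 1 ≡ 1 ℕ.* (n ℕ.* 1)
  lem = ℕₚ.*-assoc 1 n 1

∑ : ∀ {A : Set} → List A → (A → ℚ) → ℚ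
∑ xs f = sumℚ (map f xs)

module _ {A : Set} where

  ∑-cong-∈ : ∀ (xs : List A) {f g : A → ℚ} → (∀ {x} → x ∈ xs → f x ≡ g x) → ∑ xs f ≡ ∑ xs g
  ∑-cong-∈ []       e = refl
  ∑-cong-∈ (x ∷ xs) e = cong₂ _+_ (e (here refl)) (∑-cong-∈ xs (e ∘ there))

  ∑-cong : ∀ (xs : List A) {f g : A → ℚ} → (∀ x → f x ≡ g x) → ∑ xs f ≡ ∑ xs g
  ∑-cong xs e = ∑-cong-∈ xs λ {x} _ → e x

  ∑-++ : ∀ (xs ys : List A) f → ∑ (xs ++ ys) f ≡ ∑ xs f + ∑ ys f
  ∑-++ []       ys f = sym (ℚₚ.+-identityˡ _)
  ∑-++ (x ∷ xs) ys f = trans (cong (f x +_) (∑-++ xs ys f)) (sym (ℚₚ.+-assoc (f x) (∑ xs f) (∑ ys f)))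

  ∑-+ : ∀ (xs : List A) f g → ∑ xs (λ x → f x + g x) ≡ ∑ xs f + ∑ xs g
  ∑-+ []       f g = sym (ℚₚ.+-identityˡ _)
  ∑-+ (x ∷ xs) f g = trans (cong (f x + g x +_) (∑-+ xs f g))
    (solve 4 (λ a b c d → (a :+ b) :+ (c :+ d) := (a :+ c) :+ (b :+ d)) refl (f x) (g x) (∑ xs f) (∑ xs g))

  ∑-*ˡ : ∀ (xs : List A) c f → ∑ xs (λ x → c * f x) ≡ c * ∑ xs f
  ∑-*ˡ []       c f = sym (ℚₚ.*-zeroʳ c)
  ∑-*ˡ (x ∷ xs) c f = trans (cong (c * f x +_) (∑-*ˡ xs c f)) (sym (ℚₚ.*-distribˡ-+ c (f x) (∑ xs f)))

  ∑-*ʳ : ∀ (xs : List A) c f → ∑ xs (λ x → f x * c) ≡ ∑ xs f * c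
  ∑-*ʳ xs c f = trans (∑-cong xs λ x → ℚₚ.*-comm (f x) c) (trans (∑-*ˡ xs c f) (ℚₚ.*-comm c (∑ xs f)))

  ∑-const : ∀ (xs : List A) c → ∑ xs (λ _ → c) ≡ fromℕ (length xs) * c
  ∑-const []       c = sym (ℚₚ.*-zeroˡ c)
  ∑-const (x ∷ xs) c = trans (cong (c +_) (∑-const xs c)) (trans
    (solve 2 (λ a l → a :+ l :* a := (con 1ℚ :+ l) :* a) refl c (fromℕ (length xs)))
    (cong (_* c) (sym (fromℕ-homo-+ 1 (length xs)))))

  ∑-0 : ∀ (xs : List A) → ∑ xs (λ _ → 0ℚ) ≡ 0ℚ
  ∑-0 xs = trans (∑-const xs 0ℚ) (ℚₚ.*-zeroʳ (fromℕ (length xs)))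

∑-swap : ∀ {A B : Set} (xs : List A) (ys : List B) (f : A → B → ℚ) →
         ∑ xs (λ x → ∑ ys (f x)) ≡ ∑ ys (λ y → ∑ xs λ x → f x y)
∑-swap []       ys f = sym (∑-0 ys)
∑-swap (x ∷ xs) ys f = trans (cong (∑ ys (f x) +_) (∑-swap xs ys f)) (sym (∑-+ ys (f x) (λ y → ∑ xs λ x → f x y)))

∑-sum-swap : ∀ {A : Set} {n} (xs : List A) (f : A → Fin n → ℚ) →
             ∑ xs (λ x → sum (f x)) ≡ sum (λ i → ∑ xs λ x → f x i)
∑-sum-swap {n = n} []       f = sym (sum-replicate-zero n)
∑-sum-swap         (x ∷ xs) f = trans (cong (sum (f x) +_) (∑-sum-swap xs f))
  (sym (∑-distrib-+ (f x) (λ i → ∑ xs λ x → f x i)))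

∑-map : ∀ {A B : Set} (g : A → B) (xs : List A) f → ∑ (map g xs) f ≡ ∑ xs (f ∘ g)
∑-map g xs f = cong sumℚ (sym (map-∘ xs))

∑-cartesianProductWith : ∀ {A B C : Set} (g : A → B → C) xs ys f →
  ∑ (cartesianProductWith g xs ys) f ≡ ∑ xs (λ x → ∑ ys λ y → f (g x y))
∑-cartesianProductWith g []       ys f = refl
∑-cartesianProductWith g (x ∷ xs) ys f = trans (∑-++ (map (g x) ys) _ f)
  (cong₂ _+_ (∑-map (g x) ys f) (∑-cartesianProductWith g xs ys f))

∑-↭ : ∀ {A : Set} {xs ys : List A} → xs ↭ ys → ∀ f → ∑ xs f ≡ ∑ ys f
∑-↭ xs↭ys f = foldr-commMonoid (setoid ℚ) ℚₚ.+-0-isCommutativeMonoid (↭⇒↭ₛ (↭ₚ.map⁺ f xs↭ys))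

∑-tabulate : ∀ {A : Set} {n} (g : Fin n → A) (f : A → ℚ) →
             ∑ (tabulate g) f ≡ sum (f ∘ g)
∑-tabulate {n = zero}  g f = refl
∑-tabulate {n = suc n} g f = cong (f (g zero) +_) (∑-tabulate (g ∘ suc) f)

unique-↭ : ∀ {A : Set} {xs ys : List A} → Unique xs → Unique ys →
           (∀ {x} → x ∈ xs → x ∈ ys) → (∀ {x} → x ∈ ys → x ∈ xs) → xs ↭ ys
unique-↭ u v f g = ∼bag⇒↭ (unique∧set⇒bag u v (mk⇔ f g))

-- Sums over permutations

-- The summand receives only the underlying function. If it is `Extensional`, permutations that
-- agree pointwise but carry different proofs are interchangeable.
∑ₚ : ∀ {n} → ((Fin n → Fin n) → ℚ) → ℚ
∑ₚ {n} F = ∑ (permutations n) λ p → F (p ⟨$⟩ʳ_)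

Extensional : ∀ {n} → ((Fin n → Fin n) → ℚ) → Set
Extensional F = ∀ {f g} → f ≗ g → F f ≡ F g

insertᵢ-cong : ∀ {n} {k i j : Fin (suc n)} {π ρ : Permutation′ n} →
               i ≡ j → π Perm.≈ ρ → insert k i π Perm.≈ insert k j ρ
insertᵢ-cong {k = k} {i} refl e l with k Fin.≟ l
... | yes _ = refl
... | no k≢l = cong (punchIn i) (e (punchOut k≢l))

insert-at : ∀ {n} (i j : Fin (suc n)) (π : Permutation′ n) → insert i j π ⟨$⟩ʳ i ≡ j
insert-at i j π with i Fin.≟ i
... | yes _  = refl
... | no i≢i = contradiction refl i≢i

insertᵢ-injective : ∀ {n} {k i j : Fin (suc n)} {π ρ : Permutation′ n} →
                    insert k i π Perm.≈ insert k j ρ → i ≡ j × π Perm.≈ ρ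
insertᵢ-injective {k = k} {i} {j} {π} {ρ} e
  with refl ← trans (sym (insert-at k i π)) (trans (e k) (insert-at k j ρ)) =
  refl , λ l → punchIn-injective i _ _ (trans (sym (insert-punchIn k i π l))
    (trans (e (punchIn k l)) (insert-punchIn k i ρ l)))

module _ {n : ℕ} (i : Fin (suc n)) where

  -- `permutations` classifies by the value at position zero; this list classifies by the value at
  -- an arbitrary position `i`.
  insertions : List (Permutation′ (suc n))
  insertions = cartesianProductWith (insert i) (allFin (suc n)) (permutations n)

  insertions-complete : (π : Permutation′ (suc n)) → Any (π Perm.≈_) insertions
  insertions-complete π = cartesianProductWith⁺ (insert i)
    (λ {j} {ρ} j≡ e l → trans (sym (insert-remove i π l))
      (insertᵢ-cong {k = i} {π = remove i π} {ρ = ρ} j≡ e l))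
    (∈-allFin (π ⟨$⟩ʳ i))
    (permutations-complete (remove i π))

  insertions-unique : Uniqueₛ.Unique (≈-setoid (suc n)) insertions
  insertions-unique = Uniqueₛₚ.cartesianProductWith⁺ (setoid _) (≈-setoid n) (≈-setoid (suc n))
    (insert i) (λ {_} {_} {π} {ρ} → insertᵢ-injective {k = i} {π = π} {ρ = ρ})
    (Uniqueₚ.allFin⁺ (suc n)) (permutations-unique n)

-- Equality of these vectors is pointwise equality of the permutations. Passing to them makes the
-- two enumerations comparable as lists with propositional equality, where "no repetitions and the
-- same members" gives a reordering.
oneLine : ∀ {n} → Permutation′ n → Vec (Fin n) n
oneLine p = Vec.tabulate (p ⟨$⟩ʳ_)

oneLine-cong : ∀ {n} {π ρ : Permutation′ n} → π Perm.≈ ρ → oneLine π ≡ oneLine ρ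
oneLine-cong = Vecₚ.tabulate-cong

oneLine-injective : ∀ {n} {π ρ : Permutation′ n} → oneLine π ≡ oneLine ρ → π Perm.≈ ρ
oneLine-injective {π = π} {ρ} e i = trans (sym (Vecₚ.lookup∘tabulate (π ⟨$⟩ʳ_) i))
  (trans (cong (λ v → lookup v i) e) (Vecₚ.lookup∘tabulate (ρ ⟨$⟩ʳ_) i))

complete-∈ : ∀ {n} {ps qs : List (Permutation′ n)} → (∀ π → Any (π Perm.≈_) qs) →
             ∀ {v} → v ∈ map oneLine ps → v ∈ map oneLine qs
complete-∈ c v∈ with π , _ , refl ← ∈-map⁻ oneLine v∈ = Anyₚ.map⁺ (Any.map (λ {ρ} → oneLine-cong {π = π} {ρ}) (c π))

-- Both enumerations list every permutation exactly once up to pointwise equality, so they have the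
-- same one-line vectors in some order.
∑ₚ-insert : ∀ {n} (i : Fin (suc n)) {F} → Extensional F →
            ∑ₚ F ≡ sum (λ v → ∑ (permutations n) λ π → F (insert i v π ⟨$⟩ʳ_))
∑ₚ-insert {n} i {F} ext = begin
  ∑ (permutations (suc n)) (λ p → F (p ⟨$⟩ʳ_))         ≡⟨ viaOneLine (permutations (suc n)) ⟩
  ∑ (map oneLine (permutations (suc n))) (F ∘ lookup) ≡⟨ ∑-↭ same (F ∘ lookup) ⟩
  ∑ (map oneLine (insertions i)) (F ∘ lookup)          ≡⟨ viaOneLine (insertions i) ⟨
  ∑ (insertions i) (λ p → F (p ⟨$⟩ʳ_))
    ≡⟨ ∑-cartesianProductWith (insert i) (allFin (suc n)) (permutations n) (λ p → F (p ⟨$⟩ʳ_)) ⟩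
  ∑ (allFin (suc n)) (λ v → ∑ (permutations n) λ π → F (insert i v π ⟨$⟩ʳ_))
    ≡⟨ ∑-tabulate id (λ v → ∑ (permutations n) λ π → F (insert i v π ⟨$⟩ʳ_)) ⟩
  sum (λ v → ∑ (permutations n) λ π → F (insert i v π ⟨$⟩ʳ_)) ∎
  where
  viaOneLine : ∀ ps → ∑ ps (λ p → F (p ⟨$⟩ʳ_)) ≡ ∑ (map oneLine ps) (F ∘ lookup)
  viaOneLine ps = trans
    (∑-cong ps λ p → ext λ j → sym (Vecₚ.lookup∘tabulate (p ⟨$⟩ʳ_) j))
    (sym (∑-map oneLine ps (F ∘ lookup)))

  unique : ∀ {ps} → Uniqueₛ.Unique (≈-setoid (suc n)) ps → Unique (map oneLine ps)
  unique = Uniqueₛₚ.map⁺ (≈-setoid (suc n)) (setoid _)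
    (λ {π} {ρ} → oneLine-injective {π = π} {ρ})

  same : map oneLine (permutations (suc n)) ↭ map oneLine (insertions i)
  same = unique-↭ (unique (permutations-unique (suc n))) (unique (insertions-unique i))
    (complete-∈ {ps = permutations (suc n)} (insertions-complete i))
    (complete-∈ {ps = insertions i} permutations-complete)

-- Indicators and permutations with prescribed values

⟦_⟧ : ∀ {P : Set} → Dec P → ℚ
⟦ yes _ ⟧ = 1ℚ
⟦ no _ ⟧  = 0ℚ

⟦⟧-yes : ∀ {P : Set} (P? : Dec P) → P → ⟦ P? ⟧ ≡ 1ℚ
⟦⟧-yes (yes _) p = refl
⟦⟧-yes (no ¬p) p = contradiction p ¬p

⟦⟧-no : ∀ {P : Set} (P? : Dec P) → ¬ P → ⟦ P? ⟧ ≡ 0ℚ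
⟦⟧-no (yes p) ¬p = contradiction p ¬p
⟦⟧-no (no _)  ¬p = refl

⟦⟧-⇔ : ∀ {P Q : Set} (P? : Dec P) (Q? : Dec Q) → (P → Q) → (Q → P) → ⟦ P? ⟧ ≡ ⟦ Q? ⟧
⟦⟧-⇔ (yes p) Q? f g = sym (⟦⟧-yes Q? (f p))
⟦⟧-⇔ (no ¬p) Q? f g = sym (⟦⟧-no Q? (¬p ∘ g))

sum-0 : ∀ {n} {f : Fin n → ℚ} → (∀ i → f i ≡ 0ℚ) → sum f ≡ 0ℚ
sum-0 {n} e = trans (sum-cong-≗ e) (sum-replicate-zero n)

sum-⟦⟧ : ∀ {n} (w : Fin n) (h : Fin n → ℚ) → sum (λ v → ⟦ v Fin.≟ w ⟧ * h v) ≡ h w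
sum-⟦⟧ {suc n} w h = begin
  sum (λ v → ⟦ v Fin.≟ w ⟧ * h v)  ≡⟨ sum-remove {i = w} (λ v → ⟦ v Fin.≟ w ⟧ * h v) ⟩
  ⟦ w Fin.≟ w ⟧ * h w + sum (λ j → ⟦ punchIn w j Fin.≟ w ⟧ * h (punchIn w j))
    ≡⟨ cong₂ _+_ (cong (_* h w) (⟦⟧-yes (w Fin.≟ w) refl))
         (sum-0 λ j → trans (cong (_* h (punchIn w j)) (⟦⟧-no (punchIn w j Fin.≟ w) (punchInᵢ≢i w j)))
                            (ℚₚ.*-zeroˡ (h (punchIn w j)))) ⟩
  1ℚ * h w + 0ℚ                    ≡⟨ trans (ℚₚ.+-identityʳ (1ℚ * h w)) (ℚₚ.*-identityˡ (h w)) ⟩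
  h w                              ∎

∑-permutations-const : ∀ n c → ∑ (permutations n) (λ _ → c) ≡ fromℕ (n !) * c
∑-permutations-const n c = trans (∑-const (permutations n) c)
  (cong (λ m → fromℕ m * c) (length-permutations n))

∑ₚ-fix : ∀ {n} (i w : Fin (suc n)) {G} → Extensional G →
         ∑ₚ (λ f → ⟦ f i Fin.≟ w ⟧ * G f) ≡ ∑ (permutations n) λ π → G (insert i w π ⟨$⟩ʳ_)
∑ₚ-fix {n} i w {G} ext = begin
  ∑ₚ (λ f → ⟦ f i Fin.≟ w ⟧ * G f)
    ≡⟨ ∑ₚ-insert i {λ f → ⟦ f i Fin.≟ w ⟧ * G f} (λ f≗g → cong₂ _*_ (cong (λ v → ⟦ v Fin.≟ w ⟧) (f≗g i)) (ext f≗g)) ⟩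
  sum (λ v → ∑ (permutations n) λ π → ⟦ (insert i v π ⟨$⟩ʳ i) Fin.≟ w ⟧ * G (insert i v π ⟨$⟩ʳ_))
    ≡⟨ sum-cong-≗ (λ v → trans
         (∑-cong (permutations n) λ π → cong (λ u → ⟦ u Fin.≟ w ⟧ * G (insert i v π ⟨$⟩ʳ_)) (insert-at i v π))
         (∑-*ˡ (permutations n) ⟦ v Fin.≟ w ⟧ λ π → G (insert i v π ⟨$⟩ʳ_))) ⟩
  sum (λ v → ⟦ v Fin.≟ w ⟧ * (∑ (permutations n) λ π → G (insert i v π ⟨$⟩ʳ_)))
    ≡⟨ sum-⟦⟧ w (λ v → ∑ (permutations n) λ π → G (insert i v π ⟨$⟩ʳ_)) ⟩
  ∑ (permutations n) (λ π → G (insert i w π ⟨$⟩ʳ_)) ∎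

-- The indicator of f ∘ is ≗ ws, as a product so that the tuple can be
-- peeled off one entry at a time.
agree : ∀ {r n} → (is ws : Fin r → Fin n) → (Fin n → Fin n) → ℚ
agree {zero}  is ws f = 1ℚ
agree {suc r} is ws f = ⟦ f (is zero) Fin.≟ ws zero ⟧ * agree (is ∘ suc) (ws ∘ suc) f

agree-ext : ∀ {r n} (is ws : Fin r → Fin n) → Extensional (agree is ws)
agree-ext {zero}  is ws e = refl
agree-ext {suc r} is ws e = cong₂ _*_ (cong (λ v → ⟦ v Fin.≟ ws zero ⟧) (e (is zero)))
  (agree-ext (is ∘ suc) (ws ∘ suc) e)

agree-yes : ∀ {r n} (is ws : Fin r → Fin n) {f} → (∀ j → f (is j) ≡ ws j) → agree is ws f ≡ 1ℚ
agree-yes {zero}  is ws     e = refl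
agree-yes {suc r} is ws {f} e = cong₂ _*_ (⟦⟧-yes (f (is zero) Fin.≟ ws zero) (e zero))
  (agree-yes (is ∘ suc) (ws ∘ suc) (e ∘ suc))

agree-no : ∀ {r n} (is ws : Fin r → Fin n) {f} → ¬ (∀ j → f (is j) ≡ ws j) → agree is ws f ≡ 0ℚ
agree-no {zero}  is ws     ne = contradiction (λ ()) ne
agree-no {suc r} is ws {f} ne with f (is zero) Fin.≟ ws zero
... | no _  = ℚₚ.*-zeroˡ (agree (is ∘ suc) (ws ∘ suc) f)
... | yes e = trans (ℚₚ.*-identityˡ (agree (is ∘ suc) (ws ∘ suc) f))
  (agree-no (is ∘ suc) (ws ∘ suc) λ es → ne λ { zero → e ; (suc j) → es j })

-- Away from `i`, `insert i w π` is `π` with positions relabelled by `punchIn i` and values by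
-- `punchIn w`; both relabellings are injective, so each remaining equation descends to `π`.
agree-punchIn : ∀ {r n} (i w : Fin (suc n)) (is ws : Fin r → Fin (suc n)) (is′ ws′ : Fin r → Fin n) (π : Permutation′ n) →
                is ≗ punchIn i ∘ is′ → ws ≗ punchIn w ∘ ws′ →
                agree is ws (insert i w π ⟨$⟩ʳ_) ≡ agree is′ ws′ (π ⟨$⟩ʳ_)
agree-punchIn {zero}  i w is ws is′ ws′ π e e′ = refl
agree-punchIn {suc r} i w is ws is′ ws′ π e e′ = cong₂ _*_
  (⟦⟧-⇔ ((insert i w π ⟨$⟩ʳ is zero) Fin.≟ ws zero) ((π ⟨$⟩ʳ is′ zero) Fin.≟ ws′ zero)
    (λ eq → punchIn-injective w _ _ (trans (sym img) (trans eq (e′ zero))))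
    (λ eq → trans img (trans (cong (punchIn w) eq) (sym (e′ zero)))))
  (agree-punchIn i w (is ∘ suc) (ws ∘ suc) (is′ ∘ suc) (ws′ ∘ suc) π (e ∘ suc) (e′ ∘ suc))
  where
  img : insert i w π ⟨$⟩ʳ is zero ≡ punchIn w (π ⟨$⟩ʳ is′ zero)
  img = trans (cong (insert i w π ⟨$⟩ʳ_) (e zero)) (insert-punchIn i w π (is′ zero))

-- Moments of linear rank statistics under prescribed values

Inj : ∀ {r n} → (Fin r → Fin n) → Set
Inj is = ∀ {j l} → is j ≡ is l → j ≡ l

module _ {r n : ℕ} {is : Fin (suc r) → Fin (suc n)} (inj : Inj is) where

  head≢ : ∀ j → is zero ≢ is (suc j)
  head≢ j e with () ← inj e

  peel : Fin r → Fin n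
  peel j = punchOut (head≢ j)

  punchIn-peel : ∀ j → is (suc j) ≡ punchIn (is zero) (peel j)
  punchIn-peel j = sym (punchIn-punchOut (head≢ j))

  peel-injective : Inj peel
  peel-injective {j} {l} e = Finₚ.suc-injective (inj (punchOut-injective (head≢ j) (head≢ l) e))

-- The linear rank statistic with scores `a` for positions and `b` for values. The two are kept
-- apart because deleting a position and a value restricts them differently, even when they start
-- out equal.
T : ∀ {n} → (a b : Fin n → ℚ) → (Fin n → Fin n) → ℚ
T a b f = sum λ i → a i * b (f i)

T-ext : ∀ {n} (a b : Fin n → ℚ) → Extensional (T a b)
T-ext a b e = sum-cong-≗ λ i → cong (λ v → a i * b v) (e i)

T-insert : ∀ {n} (a b : Fin (suc n) → ℚ) i w (π : Permutation′ n) →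
           T a b (insert i w π ⟨$⟩ʳ_) ≡ a i * b w + T (a ∘ punchIn i) (b ∘ punchIn w) (π ⟨$⟩ʳ_)
T-insert a b i w π = trans (sum-remove {i = i} (λ l → a l * b (insert i w π ⟨$⟩ʳ l)))
  (cong₂ _+_ (cong (λ v → a i * b v) (insert-at i w π))
    (sum-cong-≗ λ l → cong (λ v → a (punchIn i l) * b v) (insert-punchIn i w π l)))

-- Each equation removes one position and one value; what remains are the arrangements of the `t`
-- free positions.
∑ₚ-agree : ∀ r t {is ws : Fin r → Fin (r ℕ.+ t)} → Inj is → Inj ws →
           ∑ₚ (agree is ws) ≡ fromℕ (t !)
∑ₚ-agree zero    t inj inj′ = trans (∑-permutations-const t 1ℚ) (ℚₚ.*-identityʳ (fromℕ (t !)))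
∑ₚ-agree (suc r) t {is} {ws} inj inj′ = begin
  ∑ₚ (agree is ws)      ≡⟨ ∑ₚ-fix (is zero) (ws zero) (agree-ext (is ∘ suc) (ws ∘ suc)) ⟩
  ∑ (permutations (r ℕ.+ t)) (λ π → agree (is ∘ suc) (ws ∘ suc) (insert (is zero) (ws zero) π ⟨$⟩ʳ_))
    ≡⟨ ∑-cong (permutations (r ℕ.+ t)) (λ π → agree-punchIn (is zero) (ws zero) (is ∘ suc) (ws ∘ suc)
         (peel inj) (peel inj′) π (punchIn-peel inj) (punchIn-peel inj′)) ⟩
  ∑ₚ (agree (peel inj) (peel inj′)) ≡⟨ ∑ₚ-agree r t (peel-injective inj) (peel-injective inj′) ⟩
  fromℕ (t !)           ∎

∑ₚ-T : ∀ t (a b : Fin (suc t) → ℚ) → ∑ₚ (T a b) ≡ fromℕ (t !) * (sum a * sum b)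
∑ₚ-T t a b = begin
  ∑ₚ (T a b)  ≡⟨ ∑-sum-swap (permutations (suc t)) (λ p i → a i * b (p ⟨$⟩ʳ i)) ⟩
  sum (λ i → ∑ₚ λ f → a i * b (f i))
    ≡⟨ sum-cong-≗ (λ i → trans (∑-*ˡ (permutations (suc t)) (a i) (λ p → b (p ⟨$⟩ʳ i))) (cong (a i *_) (image i))) ⟩
  sum (λ i → a i * (fromℕ (t !) * sum b)) ≡⟨ *-distribʳ-sum (fromℕ (t !) * sum b) a ⟨
  sum a * (fromℕ (t !) * sum b)
    ≡⟨ solve 3 (λ x y z → x :* (y :* z) := y :* (x :* z)) refl (sum a) (fromℕ (t !)) (sum b) ⟩
  fromℕ (t !) * (sum a * sum b) ∎
  where
  image : ∀ i → ∑ₚ (λ f → b (f i)) ≡ fromℕ (t !) * sum b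
  image i = begin
    ∑ₚ (λ f → b (f i))   ≡⟨ ∑ₚ-insert i (λ e → cong b (e i)) ⟩
    sum (λ v → ∑ (permutations t) λ π → b (insert i v π ⟨$⟩ʳ i))
      ≡⟨ sum-cong-≗ (λ v → trans (∑-cong (permutations t) λ π → cong b (insert-at i v π))
                                 (∑-permutations-const t (b v))) ⟩
    sum (λ v → fromℕ (t !) * b v) ≡⟨ *-distribˡ-sum (fromℕ (t !)) b ⟨
    fromℕ (t !) * sum b  ∎

-- There are `suc t !` permutations that meet the equations, and each contributes the prescribed
-- products. Every free position takes every free value in `t !` of them, which gives the product of
-- the two leftover score sums. The induction peels off one equation at a time, down to `∑ₚ-T`.
∑ₚ-agree-T : ∀ r t {is ws : Fin r → Fin (r ℕ.+ suc t)} → Inj is → Inj ws → ∀ a b →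
  ∑ₚ (λ f → agree is ws f * T a b f) ≡
  fromℕ (t !) * (fromℕ (suc t) * (sum λ j → a (is j) * b (ws j))
                 + (sum a - sum (a ∘ is)) * (sum b - sum (b ∘ ws)))
∑ₚ-agree-T zero t inj inj′ a b = begin
  ∑ₚ (λ f → 1ℚ * T a b f) ≡⟨ ∑-cong (permutations (suc t)) (λ p → ℚₚ.*-identityˡ (T a b (p ⟨$⟩ʳ_))) ⟩
  ∑ₚ (T a b)              ≡⟨ ∑ₚ-T t a b ⟩
  fromℕ (t !) * (sum a * sum b)
    ≡⟨ solve 4 (λ f s x y → f :* (x :* y) := f :* (s :* con 0ℚ :+ (x :- con 0ℚ) :* (y :- con 0ℚ))) refl
         (fromℕ (t !)) (fromℕ (suc t)) (sum a) (sum b) ⟩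
  fromℕ (t !) * (fromℕ (suc t) * 0ℚ + (sum a - 0ℚ) * (sum b - 0ℚ)) ∎
∑ₚ-agree-T (suc r) t {is} {ws} inj inj′ a b = begin
  ∑ₚ (λ f → ⟦ f i Fin.≟ w ⟧ * agree (is ∘ suc) (ws ∘ suc) f * T a b f)
    ≡⟨ ∑-cong (permutations (suc n)) (λ p → ℚₚ.*-assoc ⟦ (p ⟨$⟩ʳ i) Fin.≟ w ⟧ _ _) ⟩
  ∑ₚ (λ f → ⟦ f i Fin.≟ w ⟧ * (agree (is ∘ suc) (ws ∘ suc) f * T a b f))
    ≡⟨ ∑ₚ-fix i w (λ e → cong₂ _*_ (agree-ext (is ∘ suc) (ws ∘ suc) e) (T-ext a b e)) ⟩
  ∑ (permutations n) (λ π → agree (is ∘ suc) (ws ∘ suc) (insert i w π ⟨$⟩ʳ_) * T a b (insert i w π ⟨$⟩ʳ_))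
    ≡⟨ ∑-cong (permutations n) (λ π → trans
         (cong₂ _*_ (agree-punchIn i w (is ∘ suc) (ws ∘ suc) (peel inj) (peel inj′) π (punchIn-peel inj) (punchIn-peel inj′))
                    (T-insert a b i w π))
         (trans (ℚₚ.*-distribˡ-+ (agree′ (π ⟨$⟩ʳ_)) (a i * b w) (T a′ b′ (π ⟨$⟩ʳ_)))
           (cong (_+ agree′ (π ⟨$⟩ʳ_) * T a′ b′ (π ⟨$⟩ʳ_)) (ℚₚ.*-comm (agree′ (π ⟨$⟩ʳ_)) (a i * b w))))) ⟩
  ∑ₚ (λ f → a i * b w * agree′ f + agree′ f * T a′ b′ f)
    ≡⟨ ∑-+ (permutations n) (λ π → a i * b w * agree′ (π ⟨$⟩ʳ_)) (λ π → agree′ (π ⟨$⟩ʳ_) * T a′ b′ (π ⟨$⟩ʳ_)) ⟩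
  ∑ₚ (λ f → a i * b w * agree′ f) + ∑ₚ (λ f → agree′ f * T a′ b′ f)
    ≡⟨ cong₂ _+_
         (trans (∑-*ˡ (permutations n) (a i * b w) (λ π → agree′ (π ⟨$⟩ʳ_)))
           (cong (a i * b w *_) (trans (∑ₚ-agree r (suc t) (peel-injective inj) (peel-injective inj′))
                                       (fromℕ-homo-* (suc t) (t !)))))
         (∑ₚ-agree-T r t (peel-injective inj) (peel-injective inj′) a′ b′) ⟩
  a i * b w * (fromℕ (suc t) * fromℕ (t !)) +
  fromℕ (t !) * (fromℕ (suc t) * (sum λ j → a′ (peel inj j) * b′ (peel inj′ j))
                 + (sum a′ - sum (a′ ∘ peel inj)) * (sum b′ - sum (b′ ∘ peel inj′)))
    ≡⟨ cong (λ z → a i * b w * (fromℕ (suc t) * fromℕ (t !)) + fromℕ (t !) * z)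
         (cong₂ _+_
           (cong (fromℕ (suc t) *_) (sum-cong-≗ λ j → cong₂ (λ x y → a x * b y) (sym (punchIn-peel inj j)) (sym (punchIn-peel inj′ j))))
           (cong₂ _*_ (cong (λ z → sum a′ - z) (sum-cong-≗ λ j → cong a (sym (punchIn-peel inj j))))
                      (cong (λ z → sum b′ - z) (sum-cong-≗ λ j → cong b (sym (punchIn-peel inj′ j)))))) ⟩
  a i * b w * (fromℕ (suc t) * fromℕ (t !)) +
  fromℕ (t !) * (fromℕ (suc t) * S + (sum a′ - sum (a ∘ is ∘ suc)) * (sum b′ - sum (b ∘ ws ∘ suc)))
    ≡⟨ solve 9 (λ x y s f S p p′ q q′ →
         x :* y :* (s :* f) :+ f :* (s :* S :+ (p :- p′) :* (q :- q′)) :=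
         f :* (s :* (x :* y :+ S) :+ ((x :+ p) :- (x :+ p′)) :* ((y :+ q) :- (y :+ q′)))) refl
         (a i) (b w) (fromℕ (suc t)) (fromℕ (t !)) S (sum a′) (sum (a ∘ is ∘ suc)) (sum b′) (sum (b ∘ ws ∘ suc)) ⟩
  fromℕ (t !) * (fromℕ (suc t) * (a i * b w + S)
                 + ((a i + sum a′) - (a i + sum (a ∘ is ∘ suc))) * ((b w + sum b′) - (b w + sum (b ∘ ws ∘ suc))))
    ≡⟨ cong₂ (λ x y → fromℕ (t !) * (fromℕ (suc t) * (a i * b w + S)
         + (x - (a i + sum (a ∘ is ∘ suc))) * (y - (b w + sum (b ∘ ws ∘ suc)))))
         (sum-remove {i = i} a) (sum-remove {i = w} b) ⟨
  fromℕ (t !) * (fromℕ (suc t) * (a i * b w + S)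
                 + (sum a - (a i + sum (a ∘ is ∘ suc))) * (sum b - (b w + sum (b ∘ ws ∘ suc)))) ∎
  where
  n  = r ℕ.+ suc t
  i  = is zero
  w  = ws zero
  a′ = a ∘ punchIn i
  b′ = b ∘ punchIn w
  agree′ = agree (peel inj) (peel inj′)
  S = sum λ j → a (is (suc j)) * b (ws (suc j))

-- Occurrences as pairs of increasing tuples: positions and values

shift : ∀ {k n} → Vec (Fin n) k → Vec (Fin (suc n)) k
shift = Vec.map Fin.suc

prependZero : ∀ {k n} → Vec (Fin n) k → Vec (Fin (suc n)) (suc k)
prependZero is = zero ∷ shift is

-- The recursion follows Pascal's rule: a tuple either starts at position zero or avoids it. The
-- inductions behind `pascal` and `∑-w` use this split.
increasing : ∀ k n → List (Vec (Fin n) k)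
increasing zero    n       = [ [] ]
increasing (suc k) zero    = []
increasing (suc k) (suc n) = map prependZero (increasing k n)
                          ++ map shift (increasing (suc k) n)

lookup-suc : ∀ {k n} (is : Vec (Fin n) k) j → lookup (shift is) j ≡ Fin.suc (lookup is j)
lookup-suc is j = Vecₚ.lookup-map j Fin.suc is

shift-Increasing : ∀ {k n} (is : Vec (Fin n) k) → Increasing is → Increasing (shift is)
shift-Increasing is inc j r j<r = subst₂ Fin._<_
  (sym (lookup-suc is j)) (sym (lookup-suc is r)) (ℕ.s<s (inc j r j<r))

shift-Increasing⁻ : ∀ {k n} (is : Vec (Fin n) k) → Increasing (shift is) → Increasing is
shift-Increasing⁻ is inc j r j<r = ℕ.s<s⁻¹ (subst₂ Fin._<_
  (lookup-suc is j) (lookup-suc is r) (inc j r j<r))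

∷-Increasing : ∀ {k n} {i : Fin n} {is : Vec (Fin n) k} →
               (∀ j → i Fin.< lookup is j) → Increasing is → Increasing (i ∷ is)
∷-Increasing i< inc zero    (suc r) _   = i< r
∷-Increasing i< inc (suc j) (suc r) j<r = inc j r (ℕ.s<s⁻¹ j<r)

tail-Increasing : ∀ {k n} {i : Fin n} {is : Vec (Fin n) k} → Increasing (i ∷ is) → Increasing is
tail-Increasing inc j r j<r = inc (suc j) (suc r) (ℕ.s<s j<r)

positive⇒shift : ∀ {k n} (is : Vec (Fin (suc n)) k) → (∀ j → zero {n} Fin.< lookup is j) →
                   ∃ λ is′ → is ≡ shift is′
positive⇒shift []           pos = [] , refl
positive⇒shift (zero ∷ is)  pos with () ← pos zero
positive⇒shift (suc i ∷ is) pos with is′ , refl ← positive⇒shift is (pos ∘ suc) = i ∷ is′ , refl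

increasing⇒Increasing : ∀ k n {is : Vec (Fin n) k} → is ∈ increasing k n → Increasing is
increasing⇒Increasing zero    n       (here refl) ()
increasing⇒Increasing (suc k) (suc n) is∈ with ∈-++⁻ (map prependZero (increasing k n)) is∈
... | inj₁ ∈₁ with is′ , is′∈ , refl ← ∈-map⁻ prependZero ∈₁ =
  ∷-Increasing {is = shift is′} (λ j → subst (zero {n} Fin.<_) (sym (lookup-suc is′ j)) ℕ.z<s)
    (shift-Increasing is′ (increasing⇒Increasing k n is′∈))
... | inj₂ ∈₂ with is′ , is′∈ , refl ← ∈-map⁻ shift ∈₂ =
  shift-Increasing is′ (increasing⇒Increasing (suc k) n is′∈)

Increasing⇒increasing : ∀ k n (is : Vec (Fin n) k) → Increasing is → is ∈ increasing k n
Increasing⇒increasing zero    n       []           inc = here refl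
Increasing⇒increasing (suc k) (suc n) (zero ∷ is)  inc
  with is′ , refl ← positive⇒shift is (λ j → inc zero (suc j) ℕ.z<s) =
  ∈-++⁺ˡ (∈-map⁺ prependZero
    (Increasing⇒increasing k n is′ (shift-Increasing⁻ is′ (tail-Increasing {is = shift is′} inc))))
Increasing⇒increasing (suc k) (suc n) (suc i ∷ is) inc
  with is′ , refl ← positive⇒shift is (λ j → ℕₚ.<-trans ℕ.z<s (inc zero (suc j) ℕ.z<s)) =
  ∈-++⁺ʳ _ (∈-map⁺ shift
    (Increasing⇒increasing (suc k) n (i ∷ is′) (shift-Increasing⁻ (i ∷ is′) inc)))

shift-injective : ∀ {k n} {is js : Vec (Fin n) k} → shift is ≡ shift js → is ≡ js
shift-injective {is = []}     {[]}     e = refl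
shift-injective {is = i ∷ is} {j ∷ js} e with e₁ , e₂ ← Vecₚ.∷-injective e =
  cong₂ _∷_ (Finₚ.suc-injective e₁) (shift-injective e₂)

increasing-unique : ∀ k n → Unique (increasing k n)
increasing-unique zero    n       = [] ∷ []
increasing-unique (suc k) zero    = []
increasing-unique (suc k) (suc n) = Uniqueₚ.++⁺
  (Uniqueₚ.map⁺ (shift-injective ∘ Vecₚ.∷-injectiveʳ) (increasing-unique k n))
  (Uniqueₚ.map⁺ shift-injective (increasing-unique (suc k) n))
  λ (∈₁ , ∈₂) → disjoint ∈₁ ∈₂
  where
  disjoint : ∀ {is} → is ∈ map prependZero (increasing k n) →
             is ∉ map shift (increasing (suc k) n)
  disjoint ∈₁ ∈₂ with ∈-map⁻ prependZero ∈₁ | ∈-map⁻ shift ∈₂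
  ... | _ , _ , refl | (_ ∷ _) , _ , ()

∑-filter : ∀ {A : Set} {P : A → Set} (P? : Decidable P) xs →
           fromℕ (length (filter P? xs)) ≡ ∑ xs λ x → ⟦ P? x ⟧
∑-filter P? []       = refl
∑-filter P? (x ∷ xs) with P? x
... | yes _ = trans (fromℕ-homo-+ 1 (length (filter P? xs))) (cong (1ℚ +_) (∑-filter P? xs))
... | no _  = trans (∑-filter P? xs) (sym (ℚₚ.+-identityˡ (∑ xs λ x → ⟦ P? x ⟧)))

module _ {A : Set} (_≟_ : DecidableEquality A) where

  ∑-∉ : ∀ xs {y} → y ∉ xs → ∑ xs (λ x → ⟦ x ≟ y ⟧) ≡ 0ℚ
  ∑-∉ xs {y} y∉ = trans (∑-cong-∈ xs λ {x} x∈ → ⟦⟧-no (x ≟ y) λ { refl → y∉ x∈ }) (∑-0 xs)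

  ∑-∈-unique : ∀ {xs y} → Unique xs → y ∈ xs → ∑ xs (λ x → ⟦ x ≟ y ⟧) ≡ 1ℚ
  ∑-∈-unique {x ∷ xs} {y} (x∉ ∷ u) (here refl) = trans
    (cong₂ _+_ (⟦⟧-yes (x ≟ x) refl) (∑-∉ xs λ x∈ → All.lookup x∉ x∈ refl)) refl
  ∑-∈-unique {x ∷ xs} {y} (x∉ ∷ u) (there y∈) = trans
    (cong₂ _+_ (⟦⟧-no (x ≟ y) λ { refl → All.lookup x∉ y∈ refl }) (∑-∈-unique u y∈)) refl

module _ {k n : ℕ} (q : Permutation′ k) (p : Permutation′ n) where

  -- The entries of p at the positions is, in increasing order if these
  -- positions carry a copy of q.
  sortedBy : Vec (Fin n) k → Vec (Fin n) k
  sortedBy is = Vec.tabulate λ l → p ⟨$⟩ʳ lookup is (q ⟨$⟩ˡ l)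

  lookup-sortedBy : ∀ is j → lookup (sortedBy is) (q ⟨$⟩ʳ j) ≡ p ⟨$⟩ʳ lookup is j
  lookup-sortedBy is j = trans (Vecₚ.lookup∘tabulate _ (q ⟨$⟩ʳ j))
    (cong (λ l → p ⟨$⟩ʳ lookup is l) (inverseˡ q))

  SameOrder⇒Increasing : ∀ is → SameOrder q p is → Increasing (sortedBy is)
  SameOrder⇒Increasing is so l m l<m
    rewrite Vecₚ.lookup∘tabulate (λ l → p ⟨$⟩ʳ lookup is (q ⟨$⟩ˡ l)) l
          | Vecₚ.lookup∘tabulate (λ l → p ⟨$⟩ʳ lookup is (q ⟨$⟩ˡ l)) m =
    Equivalence.to (so (q ⟨$⟩ˡ l) (q ⟨$⟩ˡ m))
      (subst₂ Fin._<_ (sym (inverseʳ q)) (sym (inverseʳ q)) l<m)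

  Increasing⇒SameOrder : ∀ is → Increasing (sortedBy is) → SameOrder q p is
  Increasing⇒SameOrder is inc j r = mk⇔ to from
    where
    to : ∀ {j r} → (q ⟨$⟩ʳ j) Fin.< (q ⟨$⟩ʳ r) → (p ⟨$⟩ʳ lookup is j) Fin.< (p ⟨$⟩ʳ lookup is r)
    to {j} {r} lt = subst₂ Fin._<_ (lookup-sortedBy is j) (lookup-sortedBy is r)
      (inc (q ⟨$⟩ʳ j) (q ⟨$⟩ʳ r) lt)

    from : (p ⟨$⟩ʳ lookup is j) Fin.< (p ⟨$⟩ʳ lookup is r) → (q ⟨$⟩ʳ j) Fin.< (q ⟨$⟩ʳ r)
    from lt with Finₚ.<-cmp (q ⟨$⟩ʳ j) (q ⟨$⟩ʳ r)
    ... | tri< qj<qr _ _ = qj<qr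
    ... | tri> _ _ qr<qj = contradiction lt (ℕₚ.<-asym (to {r} {j} qr<qj))
    ... | tri≈ _ e _ = contradiction lt (ℕₚ.<-irrefl (cong Fin.toℕ
      (trans (sym (lookup-sortedBy is j)) (trans (cong (lookup (sortedBy is)) e) (lookup-sortedBy is r)))))

  -- If the entries at `is` form a copy of `q`, exactly one increasing tuple `us` of values
  -- satisfies the equations, namely `sortedBy is`; otherwise `sortedBy is` is not increasing and
  -- none does. An order condition thus becomes a sum of equality conditions, to which `∑ₚ-agree-T`
  -- applies.
  occurrence-indicator : ∀ {is} → is ∈ increasing k n → ⟦ isOccurrence? q p is ⟧ ≡
    ∑ (increasing k n) λ us → agree (lookup is) (lookup us ∘ (q ⟨$⟩ʳ_)) (p ⟨$⟩ʳ_)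
  occurrence-indicator {is} is∈ = trans indicator (sym (∑-cong (increasing k n) toVecEq))
    where
    _≟ᵥ_ : DecidableEquality (Vec (Fin n) k)
    _≟ᵥ_ = Vecₚ.≡-dec Fin._≟_

    toVecEq : ∀ us → agree (lookup is) (lookup us ∘ (q ⟨$⟩ʳ_)) (p ⟨$⟩ʳ_) ≡ ⟦ us ≟ᵥ sortedBy is ⟧
    toVecEq us with us ≟ᵥ sortedBy is
    ... | yes refl = agree-yes (lookup is) _ λ j → sym (lookup-sortedBy is j)
    ... | no us≢   = agree-no (lookup is) _ λ e → us≢ (trans (sym (Vecₚ.tabulate∘lookup us))
      (Vecₚ.tabulate-cong λ l → sym (trans (e (q ⟨$⟩ˡ l)) (cong (lookup us) (inverseʳ q)))))

    indicator : ⟦ isOccurrence? q p is ⟧ ≡ ∑ (increasing k n) λ us → ⟦ us ≟ᵥ sortedBy is ⟧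
    indicator with isOccurrence? q p is
    ... | yes (_ , so) = sym (∑-∈-unique _≟ᵥ_ (increasing-unique k n)
      (Increasing⇒increasing k n (sortedBy is) (SameOrder⇒Increasing is so)))
    ... | no ¬occ = sym (∑-∉ _≟ᵥ_ (increasing k n) λ s∈ → ¬occ
      (increasing⇒Increasing k n is∈ , Increasing⇒SameOrder is (increasing⇒Increasing k n s∈)))

  X-agree : X q n p ≡ ∑ (increasing k n) λ is → ∑ (increasing k n) λ us →
                      agree (lookup is) (lookup us ∘ (q ⟨$⟩ʳ_)) (p ⟨$⟩ʳ_)
  X-agree = begin
    -- An occurrence is increasing by definition, so restricting the search to increasing tuples
    -- loses nothing.
    fromℕ (length (filter occ? (tuples k n)))       ≡⟨ cong fromℕ (↭ₚ.↭-length same) ⟩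
    fromℕ (length (filter occ? (increasing k n)))   ≡⟨ ∑-filter occ? (increasing k n) ⟩
    ∑ (increasing k n) (λ is → ⟦ occ? is ⟧)         ≡⟨ ∑-cong-∈ (increasing k n) occurrence-indicator ⟩
    ∑ (increasing k n) (λ is → ∑ (increasing k n) λ us →
                      agree (lookup is) (lookup us ∘ (q ⟨$⟩ʳ_)) (p ⟨$⟩ʳ_)) ∎
    where
    occ? = isOccurrence? q p
    same : filter occ? (tuples k n) ↭ filter occ? (increasing k n)
    same = unique-↭ (Uniqueₚ.filter⁺ occ? (tuples-unique k n)) (Uniqueₚ.filter⁺ occ? (increasing-unique k n))
      (λ {is} is∈ → let _ , occ = ∈-filter⁻ occ? {xs = tuples k n} is∈ in
        ∈-filter⁺ occ? (Increasing⇒increasing k n is (proj₁ occ)) occ)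
      (λ {is} is∈ → let _ , occ = ∈-filter⁻ occ? {xs = increasing k n} is∈ in
        ∈-filter⁺ occ? (tuples-complete is) occ)

-- The weights

fromℕ-suc : ∀ n → fromℕ (suc n) ≡ 1ℚ + fromℕ n
fromℕ-suc = fromℕ-homo-+ 1

recip : ∀ n → ℚ
recip n = ℤ.+ 1 / suc n

recip-inverse : ∀ n → recip n * fromℕ (suc n) ≡ 1ℚ
recip-inverse n = 1/n*n≡1 (suc n)

sum-const : ∀ n c → sum {n} (λ _ → c) ≡ fromℕ n * c
sum-const zero    c = sym (ℚₚ.*-zeroˡ c)
sum-const (suc n) c = begin
  c + sum {n} (λ _ → c)  ≡⟨ cong (c +_) (sum-const n c) ⟩
  c + fromℕ n * c        ≡⟨ solve 2 (λ c n → c :+ n :* c := (con 1ℚ :+ n) :* c) refl c (fromℕ n) ⟩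
  (1ℚ + fromℕ n) * c     ≡⟨ cong (_* c) (fromℕ-suc n) ⟨
  fromℕ (suc n) * c      ∎

sum-minus-const : ∀ {n} (f : Fin n → ℚ) c → sum (λ i → f i - c) ≡ sum f - fromℕ n * c
sum-minus-const {n} f c = begin
  sum (λ i → f i + - c)         ≡⟨ ∑-distrib-+ f (λ _ → - c) ⟩
  sum f + sum {n} (λ _ → - c)   ≡⟨ cong (sum f +_) (sum-const n (- c)) ⟩
  sum f + fromℕ n * - c         ≡⟨ solve 3 (λ s n c → s :+ n :* (:- c) := s :- n :* c) refl (sum f) (fromℕ n) c ⟩
  sum f - fromℕ n * c           ∎

-- Taken as a count, so that constant sums over `increasing k n` produce it directly; its arithmetic
-- is recovered from `pascal` and `absorption`.
binomial : ℕ → ℕ → ℚ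
binomial k n = fromℕ (length (increasing k n))

length-pascal : ∀ k n → length (increasing (suc k) (suc n)) ≡ length (increasing k n) ℕ.+ length (increasing (suc k) n)
length-pascal k n = trans (length-++ (map prependZero (increasing k n)))
  (cong₂ ℕ._+_ (length-map prependZero (increasing k n)) (length-map shift (increasing (suc k) n)))

pascal : ∀ k n → binomial (suc k) (suc n) ≡ binomial k n + binomial (suc k) n
pascal k n = trans (cong fromℕ (length-pascal k n)) (fromℕ-homo-+ (length (increasing k n)) _)

absorption : ∀ k n → fromℕ (suc k) * binomial (suc k) (suc n) ≡ fromℕ (suc n) * binomial k n
absorption zero    zero    = refl
absorption (suc k) zero    = trans (ℚₚ.*-zeroʳ (fromℕ (suc (suc k)))) refl
absorption zero    (suc n) = begin
  1ℚ * binomial 1 (suc (suc n))              ≡⟨ cong (1ℚ *_) (pascal 0 (suc n)) ⟩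
  1ℚ * (1ℚ + binomial 1 (suc n))             ≡⟨ solve 1 (λ b → con 1ℚ :* (con 1ℚ :+ b) := (con 1ℚ :+ con 1ℚ :* b) :* con 1ℚ) refl (binomial 1 (suc n)) ⟩
  (1ℚ + 1ℚ * binomial 1 (suc n)) * 1ℚ        ≡⟨ cong (λ z → (1ℚ + z) * 1ℚ) (trans (absorption zero n) (ℚₚ.*-identityʳ (fromℕ (suc n)))) ⟩
  (1ℚ + fromℕ (suc n)) * 1ℚ                  ≡⟨ cong (_* 1ℚ) (fromℕ-suc (suc n)) ⟨
  fromℕ (suc (suc n)) * 1ℚ                   ∎
absorption (suc k) (suc n) = begin
  fromℕ (suc (suc k)) * binomial (suc (suc k)) (suc (suc n))
    ≡⟨ cong₂ _*_ (fromℕ-suc (suc k)) (pascal (suc k) (suc n)) ⟩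
  (1ℚ + K) * (B + B′)
    ≡⟨ solve 3 (λ K B B′ → (con 1ℚ :+ K) :* (B :+ B′) := B :+ K :* B :+ (con 1ℚ :+ K) :* B′) refl K B B′ ⟩
  B + K * B + (1ℚ + K) * B′
    ≡⟨ cong₂ (λ x y → B + x + y) (absorption k n)
         (trans (cong (_* B′) (sym (fromℕ-suc (suc k)))) (absorption (suc k) n)) ⟩
  B + N * binomial k n + N * binomial (suc k) n
    ≡⟨ solve 4 (λ B N x y → B :+ N :* x :+ N :* y := B :+ N :* (x :+ y)) refl B N (binomial k n) (binomial (suc k) n) ⟩
  B + N * (binomial k n + binomial (suc k) n)   ≡⟨ cong (λ z → B + N * z) (pascal k n) ⟨
  B + N * B                                     ≡⟨ solve 2 (λ B N → B :+ N :* B := (con 1ℚ :+ N) :* B) refl B N ⟩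
  (1ℚ + N) * B                                  ≡⟨ cong (_* B) (fromℕ-suc (suc n)) ⟨
  fromℕ (suc (suc n)) * B                       ∎
  where
  K = fromℕ (suc k)
  N = fromℕ (suc n)
  B = binomial (suc k) (suc n)
  B′ = binomial (suc (suc k)) (suc n)

-- The number of positions to the right of `i`. Counting from the right makes the weights invariant
-- under `shift`.
after : ∀ {n} → Fin n → ℕ
after {suc n} zero    = n
after         (suc i) = after i

module Weight (L : ℕ) where

  ℓ : ℚ
  ℓ = fromℕ L

  -- w m is the binomial coefficient (m + L) choose L, and w⁻¹ m is its inverse.
  w w⁻¹ : ℕ → ℚ
  w zero      = 1ℚ
  w (suc m)   = w m * (1ℚ + ℓ * recip m)
  w⁻¹ zero    = 1ℚ
  w⁻¹ (suc m) = w⁻¹ m * (fromℕ (suc m) * recip (m ℕ.+ L))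

  ratio : ∀ m → fromℕ (suc m) * (1ℚ + ℓ * recip m) ≡ fromℕ (suc (m ℕ.+ L))
  ratio m = begin
    N * (1ℚ + ℓ * recip m)  ≡⟨ solve 3 (λ N l r → N :* (con 1ℚ :+ l :* r) := N :+ l :* (r :* N)) refl N ℓ (recip m) ⟩
    N + ℓ * (recip m * N)   ≡⟨ cong (λ z → N + ℓ * z) (recip-inverse m) ⟩
    N + ℓ * 1ℚ              ≡⟨ cong (N +_) (ℚₚ.*-identityʳ ℓ) ⟩
    N + ℓ                   ≡⟨ fromℕ-homo-+ (suc m) L ⟨
    fromℕ (suc (m ℕ.+ L))   ∎
    where N = fromℕ (suc m)

  w⁻¹-step : ∀ m → w⁻¹ m ≡ w⁻¹ (suc m) * (1ℚ + ℓ * recip m)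
  w⁻¹-step m = sym (begin
    v * (N * r) * (1ℚ + ℓ * recip m)    ≡⟨ solve 4 (λ v N r x → v :* (N :* r) :* x := v :* (r :* (N :* x))) refl v N r (1ℚ + ℓ * recip m) ⟩
    v * (r * (N * (1ℚ + ℓ * recip m)))  ≡⟨ cong (λ z → v * (r * z)) (ratio m) ⟩
    v * (r * fromℕ (suc (m ℕ.+ L)))     ≡⟨ cong (v *_) (recip-inverse (m ℕ.+ L)) ⟩
    v * 1ℚ                              ≡⟨ ℚₚ.*-identityʳ v ⟩
    v                                   ∎)
    where
    v = w⁻¹ m
    N = fromℕ (suc m)
    r = recip (m ℕ.+ L)

  w-inverse : ∀ m → w m * w⁻¹ m ≡ 1ℚ
  w-inverse zero    = refl
  w-inverse (suc m) = begin
    w m * (1ℚ + ℓ * recip m) * w⁻¹ (suc m)    ≡⟨ solve 3 (λ w x v → w :* x :* v := w :* (v :* x)) refl (w m) (1ℚ + ℓ * recip m) (w⁻¹ (suc m)) ⟩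
    w m * (w⁻¹ (suc m) * (1ℚ + ℓ * recip m))  ≡⟨ cong (w m *_) (w⁻¹-step m) ⟨
    w m * w⁻¹ m                               ≡⟨ w-inverse m ⟩
    1ℚ                                        ∎

  -- The hockey-stick identity: the sum is C(n + L, L + 1), and (L + 1) C(n + L, L + 1) = n C(n + L,
  -- L).
  sum-w : ∀ n → fromℕ (suc L) * sum (λ (i : Fin n) → w (after i)) ≡ fromℕ n * w n
  sum-w zero    = trans (ℚₚ.*-zeroʳ (fromℕ (suc L))) refl
  sum-w (suc n) = begin
    fromℕ (suc L) * (w n + S)   ≡⟨ ℚₚ.*-distribˡ-+ (fromℕ (suc L)) (w n) S ⟩
    fromℕ (suc L) * w n + fromℕ (suc L) * S ≡⟨ cong₂ (λ x y → x * w n + y) (fromℕ-suc L) (sum-w n) ⟩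
    (1ℚ + ℓ) * w n + fromℕ n * w n ≡⟨ solve 3 (λ l n w → (con 1ℚ :+ l) :* w :+ n :* w := (con 1ℚ :+ (n :+ l)) :* w) refl ℓ (fromℕ n) (w n) ⟩
    (1ℚ + (fromℕ n + ℓ)) * w n     ≡⟨ cong (_* w n) (trans (fromℕ-suc (n ℕ.+ L)) (cong (1ℚ +_) (fromℕ-homo-+ n L))) ⟨
    fromℕ (suc (n ℕ.+ L)) * w n    ≡⟨ cong (_* w n) (ratio n) ⟨
    fromℕ (suc n) * (1ℚ + ℓ * recip n) * w n ≡⟨ solve 3 (λ N x w → N :* x :* w := N :* (w :* x)) refl (fromℕ (suc n)) (1ℚ + ℓ * recip n) (w n) ⟩
    fromℕ (suc n) * w (suc n)      ∎
    where S = sum (λ (i : Fin n) → w (after i))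

  β : ℚ
  β = recip L

  h a : ∀ {n} → Fin n → ℚ
  h {n} i = w (after i) * w⁻¹ n
  a i     = h i - β

  d : ∀ {k} → Permutation′ k → ℚ
  d {k} q = sum λ (j : Fin k) → a j * a (q ⟨$⟩ʳ j)

  sum-h : ∀ n → sum (h {n}) ≡ fromℕ n * β
  sum-h n = begin
    sum (h {n})                ≡⟨ *-distribʳ-sum (w⁻¹ n) (λ (i : Fin n) → w (after i)) ⟨
    S * w⁻¹ n                  ≡⟨ cong (_* w⁻¹ n) (ℚₚ.*-identityˡ S) ⟨
    1ℚ * S * w⁻¹ n             ≡⟨ cong (λ z → z * S * w⁻¹ n) (recip-inverse L) ⟨
    β * fromℕ (suc L) * S * w⁻¹ n  ≡⟨ solve 4 (λ b l s v → b :* l :* s :* v := b :* (l :* s) :* v) refl β (fromℕ (suc L)) S (w⁻¹ n) ⟩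
    β * (fromℕ (suc L) * S) * w⁻¹ n ≡⟨ cong (λ z → β * z * w⁻¹ n) (sum-w n) ⟩
    β * (fromℕ n * w n) * w⁻¹ n ≡⟨ solve 4 (λ b n w v → b :* (n :* w) :* v := n :* b :* (w :* v)) refl β (fromℕ n) (w n) (w⁻¹ n) ⟩
    fromℕ n * β * (w n * w⁻¹ n) ≡⟨ cong (fromℕ n * β *_) (w-inverse n) ⟩
    fromℕ n * β * 1ℚ           ≡⟨ ℚₚ.*-identityʳ (fromℕ n * β) ⟩
    fromℕ n * β                ∎
    where S = sum (λ (i : Fin n) → w (after i))

  sum-a : ∀ n → sum (a {n}) ≡ 0ℚ
  sum-a n = begin
    sum (a {n})                   ≡⟨ sum-minus-const (h {n}) β ⟩
    sum (h {n}) - fromℕ n * β     ≡⟨ cong (_- fromℕ n * β) (sum-h n) ⟩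
    fromℕ n * β - fromℕ n * β     ≡⟨ ℚₚ.+-inverseʳ (fromℕ n * β) ⟩
    0ℚ                            ∎

  -- The product `binomial k n * w n * w⁻¹ k` equals C(n + L, k + L), so this is Pascal's rule for
  -- those coefficients in a form that avoids factorials.
  weighted-pascal : ∀ k n → binomial (suc k) (suc n) * w (suc n) * w⁻¹ (suc k) ≡
                    binomial k n * w n * w⁻¹ k + binomial (suc k) n * w n * w⁻¹ (suc k)
  weighted-pascal k n = begin
    B * (w n * (1ℚ + ℓ * recip n)) * v
      ≡⟨ solve 5 (λ B w l r v → B :* (w :* (con 1ℚ :+ l :* r)) :* v := w :* v :* (B :+ l :* (B :* r))) refl B (w n) ℓ (recip n) v ⟩
    w n * v * (B + ℓ * (B * recip n))
      ≡⟨ cong₂ (λ x y → w n * v * (x + ℓ * y)) (pascal k n) Br ⟩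
    w n * v * (c + c′ + ℓ * (c * recip k))
      ≡⟨ solve 6 (λ w v c c′ l r → w :* v :* (c :+ c′ :+ l :* (c :* r)) := c :* w :* (v :* (con 1ℚ :+ l :* r)) :+ c′ :* w :* v)
           refl (w n) v c c′ ℓ (recip k) ⟩
    c * w n * (v * (1ℚ + ℓ * recip k)) + c′ * w n * v
      ≡⟨ cong (λ z → c * w n * z + c′ * w n * v) (w⁻¹-step k) ⟨
    c * w n * w⁻¹ k + c′ * w n * v ∎
    where
    B  = binomial (suc k) (suc n)
    c  = binomial k n
    c′ = binomial (suc k) n
    v  = w⁻¹ (suc k)
    Br : B * recip n ≡ c * recip k
    Br = begin
      B * recip n                               ≡⟨ cong (_* recip n) (trans (cong (_* B) (recip-inverse k)) (ℚₚ.*-identityˡ B)) ⟨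
      recip k * fromℕ (suc k) * B * recip n     ≡⟨ cong (_* recip n) (ℚₚ.*-assoc (recip k) (fromℕ (suc k)) B) ⟩
      recip k * (fromℕ (suc k) * B) * recip n   ≡⟨ cong (λ z → recip k * z * recip n) (absorption k n) ⟩
      recip k * (fromℕ (suc n) * c) * recip n   ≡⟨ solve 4 (λ rk N c rn → rk :* (N :* c) :* rn := c :* rk :* (rn :* N)) refl (recip k) (fromℕ (suc n)) c (recip n) ⟩
      c * recip k * (recip n * fromℕ (suc n))   ≡⟨ cong (c * recip k *_) (recip-inverse n) ⟩
      c * recip k * 1ℚ                          ≡⟨ ℚₚ.*-identityʳ (c * recip k) ⟩
      c * recip k                               ∎

  -- The averaging property before normalisation, with factor C(n + L, k + L). Splitting the tuples
  -- by whether they contain position zero reproduces the two summands of `weighted-pascal`.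
  ∑-w : ∀ k n (j : Fin k) → ∑ (increasing k n) (λ is → w (after (lookup is j))) ≡
        binomial k n * w n * w⁻¹ k * w (after j)
  ∑-w (suc k) zero    j = solve 3 (λ w v x → con 0ℚ := con 0ℚ :* w :* v :* x) refl 1ℚ (w⁻¹ (suc k)) (w (after j))
  ∑-w (suc k) (suc n) j = begin
    ∑ (increasing (suc k) (suc n)) F
      ≡⟨ ∑-++ (map prependZero (increasing k n)) (map shift (increasing (suc k) n)) F ⟩
    ∑ (map prependZero (increasing k n)) F + ∑ (map shift (increasing (suc k) n)) F
      ≡⟨ cong₂ _+_ (trans (∑-map prependZero (increasing k n) F) (first j))
           (trans (∑-map shift (increasing (suc k) n) F)
             (trans (∑-cong (increasing (suc k) n) λ is → cong (w ∘ after) (lookup-suc is j)) (∑-w (suc k) n j))) ⟩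
    binomial k n * w n * w⁻¹ k * w (after j) + binomial (suc k) n * w n * w⁻¹ (suc k) * w (after j)
      ≡⟨ ℚₚ.*-distribʳ-+ (w (after j)) (binomial k n * w n * w⁻¹ k) (binomial (suc k) n * w n * w⁻¹ (suc k)) ⟨
    (binomial k n * w n * w⁻¹ k + binomial (suc k) n * w n * w⁻¹ (suc k)) * w (after j)
      ≡⟨ cong (_* w (after j)) (weighted-pascal k n) ⟨
    binomial (suc k) (suc n) * w (suc n) * w⁻¹ (suc k) * w (after j) ∎
    where
    F = λ is → w (after (lookup is j))
    first : ∀ j → ∑ (increasing k n) (λ is → w (after (lookup (prependZero is) j))) ≡
            binomial k n * w n * w⁻¹ k * w (after j)
    -- The `zero`-th entry of each of these tuples is position zero itself, of weight `w n`; the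
    -- factor `w⁻¹ k * w k` is inserted to match the general form.
    first zero = begin
      ∑ (increasing k n) (λ _ → w n)   ≡⟨ ∑-const (increasing k n) (w n) ⟩
      binomial k n * w n               ≡⟨ ℚₚ.*-identityʳ (binomial k n * w n) ⟨
      binomial k n * w n * 1ℚ          ≡⟨ cong (binomial k n * w n *_) (w-inverse k) ⟨
      binomial k n * w n * (w k * w⁻¹ k) ≡⟨ solve 3 (λ x w v → x :* (w :* v) := x :* v :* w) refl (binomial k n * w n) (w k) (w⁻¹ k) ⟩
      binomial k n * w n * w⁻¹ k * w k ∎
    first (suc j) = trans (∑-cong (increasing k n) λ is → cong (w ∘ after) (lookup-suc is j)) (∑-w k n j)

  ∑-a : ∀ k n (j : Fin k) → ∑ (increasing k n) (λ is → a (lookup is j)) ≡ binomial k n * a j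
  ∑-a k n j = begin
    ∑ (increasing k n) (λ is → w (after (lookup is j)) * w⁻¹ n + - β)
      ≡⟨ ∑-+ (increasing k n) (λ is → w (after (lookup is j)) * w⁻¹ n) (λ _ → - β) ⟩
    ∑ (increasing k n) (λ is → w (after (lookup is j)) * w⁻¹ n) + ∑ (increasing k n) (λ _ → - β)
      ≡⟨ cong₂ _+_ (trans (∑-*ʳ (increasing k n) (w⁻¹ n) (λ is → w (after (lookup is j)))) (cong (_* w⁻¹ n) (∑-w k n j)))
                   (∑-const (increasing k n) (- β)) ⟩
    B * w n * w⁻¹ k * w (after j) * w⁻¹ n + B * - β
      ≡⟨ solve 6 (λ B w v x v′ b → B :* w :* v :* x :* v′ :+ B :* (:- b) := B :* ((w :* v′) :* (x :* v) :- b))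
           refl B (w n) (w⁻¹ k) (w (after j)) (w⁻¹ n) β ⟩
    B * (w n * w⁻¹ n * (w (after j) * w⁻¹ k) - β)
      ≡⟨ cong (λ z → B * (z - β)) (trans (cong (_* h j) (w-inverse n)) (ℚₚ.*-identityˡ (h j))) ⟩
    B * a j ∎
    where B = binomial k n

-- Order on the rationals and bounds for the weights

*-mono-≤ : ∀ {p q r s} → 0ℚ ≤ℚ p → 0ℚ ≤ℚ s → p ≤ℚ q → r ≤ℚ s → p * r ≤ℚ q * s
*-mono-≤ {p} {q} {r} {s} 0≤p 0≤s p≤q r≤s = ℚₚ.≤-trans
  (ℚₚ.*-monoˡ-≤-nonNeg p {{nonNegative 0≤p}} r≤s)
  (ℚₚ.*-monoʳ-≤-nonNeg s {{nonNegative 0≤s}} p≤q)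

0≤* : ∀ {p q} → 0ℚ ≤ℚ p → 0ℚ ≤ℚ q → 0ℚ ≤ℚ p * q
0≤* {p} {q} 0≤p 0≤q = subst (_≤ℚ p * q) (ℚₚ.*-zeroʳ p) (ℚₚ.*-monoˡ-≤-nonNeg p {{nonNegative 0≤p}} 0≤q)

0<* : ∀ {p q} → 0ℚ <ℚ p → 0ℚ <ℚ q → 0ℚ <ℚ p * q
0<* {p} {q} 0<p 0<q = subst (_<ℚ p * q) (ℚₚ.*-zeroʳ p) (ℚₚ.*-monoʳ-<-pos p {{positive 0<p}} 0<q)

0≤square : ∀ p → 0ℚ ≤ℚ p * p
0≤square p with ℚₚ.≤-total 0ℚ p
... | inj₁ 0≤p = 0≤* 0≤p 0≤p
... | inj₂ p≤0 = subst (0ℚ ≤ℚ_) (solve 1 (λ p → (:- p) :* (:- p) := p :* p) refl p)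
  (0≤* (ℚₚ.neg-antimono-≤ p≤0) (ℚₚ.neg-antimono-≤ p≤0))

p≤q⇒0≤q-p : ∀ {p q} → p ≤ℚ q → 0ℚ ≤ℚ q - p
p≤q⇒0≤q-p {p} {q} p≤q = subst (_≤ℚ q - p) (ℚₚ.+-inverseʳ p) (ℚₚ.+-monoˡ-≤ (- p) p≤q)

0≤q-p⇒p≤q : ∀ {p q} → 0ℚ ≤ℚ q - p → p ≤ℚ q
0≤q-p⇒p≤q {p} {q} 0≤ = subst₂ _≤ℚ_ (ℚₚ.+-identityˡ p)
  (solve 2 (λ p q → (q :- p) :+ p := q) refl p q) (ℚₚ.+-monoˡ-≤ p 0≤)

0≤fromℕ : ∀ n → 0ℚ ≤ℚ fromℕ n
0≤fromℕ n = ℚₚ.nonNegative⁻¹ (fromℕ n) {{ℚₚ.normalize-nonNeg n 1}}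

0<fromℕ : ∀ n → 0ℚ <ℚ fromℕ (suc n)
0<fromℕ n = ℚₚ.positive⁻¹ (fromℕ (suc n)) {{ℚₚ.normalize-pos (suc n) 1}}

0<recip : ∀ n → 0ℚ <ℚ recip n
0<recip n = ℚₚ.positive⁻¹ (recip n) {{ℚₚ.normalize-pos 1 (suc n)}}

fromℕ-mono-≤ : ∀ {m n} → m ℕ.≤ n → fromℕ m ≤ℚ fromℕ n
fromℕ-mono-≤ {m} {n} m≤n = subst₂ _≤ℚ_ (ℚₚ.+-identityʳ (fromℕ m))
  (trans (sym (fromℕ-homo-+ m (n ℕ.∸ m))) (cong fromℕ (ℕₚ.m+[n∸m]≡n m≤n)))
  (ℚₚ.+-monoʳ-≤ (fromℕ m) (0≤fromℕ (n ℕ.∸ m)))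

recip≤1 : ∀ n → recip n ≤ℚ 1ℚ
recip≤1 n = subst₂ _≤ℚ_ (ℚₚ.*-identityʳ (recip n)) (recip-inverse n)
  (ℚₚ.*-monoˡ-≤-nonNeg (recip n) {{nonNegative (ℚₚ.<⇒≤ (0<recip n))}} (fromℕ-mono-≤ (ℕ.s≤s (ℕ.z≤n {n}))))

sum-mono : ∀ {n} {f g : Fin n → ℚ} → (∀ i → f i ≤ℚ g i) → sum f ≤ℚ sum g
sum-mono {zero}  f≤g = ℚₚ.≤-refl
sum-mono {suc n} f≤g = ℚₚ.+-mono-≤ (f≤g zero) (sum-mono (f≤g ∘ suc))

∑-mono : ∀ {A : Set} (xs : List A) {f g : A → ℚ} → (∀ x → f x ≤ℚ g x) → ∑ xs f ≤ℚ ∑ xs g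
∑-mono []       f≤g = ℚₚ.≤-refl
∑-mono (x ∷ xs) f≤g = ℚₚ.+-mono-≤ (f≤g x) (∑-mono xs f≤g)

-- The difference 1 - (x - y)² factors as (1 - x + y)(1 - y + x), and both factors are nonnegative.
square≤1 : ∀ {x y} → 0ℚ ≤ℚ x → x ≤ℚ 1ℚ → 0ℚ ≤ℚ y → y ≤ℚ 1ℚ → (x - y) * (x - y) ≤ℚ 1ℚ
square≤1 {x} {y} 0≤x x≤1 0≤y y≤1 = 0≤q-p⇒p≤q (subst (0ℚ ≤ℚ_)
  (solve 2 (λ x y → ((con 1ℚ :- x) :+ y) :* ((con 1ℚ :- y) :+ x) := con 1ℚ :- (x :- y) :* (x :- y)) refl x y)
  (0≤* (ℚₚ.+-mono-≤ (p≤q⇒0≤q-p x≤1) 0≤y) (ℚₚ.+-mono-≤ (p≤q⇒0≤q-p y≤1) 0≤x)))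

after< : ∀ {n} (i : Fin n) → after i ℕ.< n
after< {suc n} zero    = ℕₚ.≤-refl
after< {suc n} (suc i) = ℕₚ.m<n⇒m<1+n (after< i)

module WeightBounds (L : ℕ) where
  open Weight L

  0≤ℓr : ∀ m → 0ℚ ≤ℚ ℓ * recip m
  0≤ℓr m = 0≤* (0≤fromℕ L) (ℚₚ.<⇒≤ (0<recip m))

  0≤w : ∀ m → 0ℚ ≤ℚ w m
  0≤w zero    = 0≤fromℕ 1
  0≤w (suc m) = 0≤* (0≤w m) (ℚₚ.+-mono-≤ (0≤fromℕ 1) (0≤ℓr m))

  0≤w⁻¹ : ∀ m → 0ℚ ≤ℚ w⁻¹ m
  0≤w⁻¹ zero    = 0≤fromℕ 1
  0≤w⁻¹ (suc m) = 0≤* (0≤w⁻¹ m) (0≤* (0≤fromℕ (suc m)) (ℚₚ.<⇒≤ (0<recip (m ℕ.+ L))))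

  w-step : ∀ m → w m ≤ℚ w (suc m)
  w-step m = subst (_≤ℚ w (suc m)) (ℚₚ.*-identityʳ (w m))
    (ℚₚ.*-monoˡ-≤-nonNeg (w m) {{nonNegative (0≤w m)}}
      (subst (_≤ℚ 1ℚ + ℓ * recip m) (ℚₚ.+-identityʳ 1ℚ) (ℚₚ.+-monoʳ-≤ 1ℚ (0≤ℓr m))))

  w-mono : ∀ {m n} → m ℕ.≤′ n → w m ≤ℚ w n
  w-mono ℕ.≤′-refl              = ℚₚ.≤-refl
  w-mono (ℕ.≤′-step {n = n} m≤) = ℚₚ.≤-trans (w-mono m≤) (w-step n)

  h-mono : ∀ {n} {i j : Fin n} → after i ℕ.≤ after j → h i ≤ℚ h j
  h-mono {n} le = ℚₚ.*-monoʳ-≤-nonNeg (w⁻¹ n) {{nonNegative (0≤w⁻¹ n)}} (w-mono (ℕₚ.≤⇒≤′ le))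

  0≤h : ∀ {n} (i : Fin n) → 0ℚ ≤ℚ h i
  0≤h {n} i = 0≤* (0≤w (after i)) (0≤w⁻¹ n)

  h≤1 : ∀ {n} (i : Fin n) → h i ≤ℚ 1ℚ
  h≤1 {n} i = subst (h i ≤ℚ_) (w-inverse n)
    (ℚₚ.*-monoʳ-≤-nonNeg (w⁻¹ n) {{nonNegative (0≤w⁻¹ n)}} (w-mono (ℕₚ.≤⇒≤′ (ℕₚ.<⇒≤ (after< i)))))

  a²≤1 : ∀ {n} (i : Fin n) → a i * a i ≤ℚ 1ℚ
  a²≤1 i = square≤1 (0≤h i) (h≤1 i) (ℚₚ.<⇒≤ (0<recip L)) (recip≤1 L)

  sum-a²≤n : ∀ n → sum (λ (i : Fin n) → a i * a i) ≤ℚ fromℕ n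
  sum-a²≤n n = subst (sum (λ (i : Fin n) → a i * a i) ≤ℚ_)
    (trans (sum-const n 1ℚ) (ℚₚ.*-identityʳ (fromℕ n))) (sum-mono {n} a²≤1)

-- Second moment of the rank statistic and its covariance with the count

Increasing⇒Inj : ∀ {k n} (is : Vec (Fin n) k) → Increasing is → Inj (lookup is)
Increasing⇒Inj is inc {j} {l} e with Finₚ.<-cmp j l
... | tri≈ _ j≡l _ = j≡l
... | tri< j<l _ _ = contradiction (inc j l j<l) (ℕₚ.<-irrefl (cong Fin.toℕ e))
... | tri> _ _ l<j = contradiction (inc l j l<j) (ℕₚ.<-irrefl (cong Fin.toℕ (sym e)))

⟨$⟩ʳ-injective : ∀ {k} (q : Permutation′ k) → Inj (q ⟨$⟩ʳ_)
⟨$⟩ʳ-injective q {j} {l} e = trans (sym (inverseˡ q)) (trans (cong (q ⟨$⟩ˡ_) e) (inverseˡ q))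

-- One of the two factors `T a b f` is expanded by position and value. Fixing a single value `f i`
-- then leaves a sum of the other factor under one equation, which `∑ₚ-agree-T` evaluates.
∑ₚ-T-square : ∀ t (a b : Fin (2 ℕ.+ t) → ℚ) → sum a ≡ 0ℚ → sum b ≡ 0ℚ →
  ∑ₚ (λ f → T a b f * T a b f) ≡
  fromℕ (t !) * (fromℕ (2 ℕ.+ t) * (sum (λ i → a i * a i) * sum (λ v → b v * b v)))
∑ₚ-T-square t a b a0 b0 = begin
  ∑ₚ (λ f → T a b f * T a b f)
    ≡⟨ ∑-cong ps (λ p → trans (*-distribʳ-sum (T′ p) (λ i → a i * b (p ⟨$⟩ʳ i))) (sum-cong-≗ λ i → expand i p)) ⟩
  ∑ ps (λ p → sum λ i → a i * sum λ v → b v * (⟦ (p ⟨$⟩ʳ i) Fin.≟ v ⟧ * T′ p))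
    ≡⟨ ∑-sum-swap ps (λ p i → a i * sum λ v → b v * (⟦ (p ⟨$⟩ʳ i) Fin.≟ v ⟧ * T′ p)) ⟩
  sum (λ i → ∑ ps λ p → a i * sum λ v → b v * (⟦ (p ⟨$⟩ʳ i) Fin.≟ v ⟧ * T′ p))
    ≡⟨ sum-cong-≗ (λ i → trans (∑-*ˡ ps (a i) (λ p → sum λ v → b v * (⟦ (p ⟨$⟩ʳ i) Fin.≟ v ⟧ * T′ p)))
         (cong (a i *_) (trans (∑-sum-swap ps (λ p v → b v * (⟦ (p ⟨$⟩ʳ i) Fin.≟ v ⟧ * T′ p)))
           (sum-cong-≗ λ v → trans (∑-*ˡ ps (b v) (λ p → ⟦ (p ⟨$⟩ʳ i) Fin.≟ v ⟧ * T′ p)) (cong (b v *_) (pair i v)))))) ⟩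
  sum (λ i → a i * sum λ v → b v * (c * (a i * b v)))
    ≡⟨ sum-cong-≗ (λ i → cong (a i *_) (trans
         (sum-cong-≗ λ v → solve 3 (λ x y c → y :* (c :* (x :* y)) := c :* x :* (y :* y)) refl (a i) (b v) c)
         (sym (*-distribˡ-sum (c * a i) λ v → b v * b v)))) ⟩
  sum (λ i → a i * (c * a i * B))
    ≡⟨ sum-cong-≗ (λ i → solve 3 (λ x c B → x :* (c :* x :* B) := c :* B :* (x :* x)) refl (a i) c B) ⟩
  sum (λ i → c * B * (a i * a i))   ≡⟨ *-distribˡ-sum (c * B) (λ i → a i * a i) ⟨
  c * B * A                         ≡⟨ solve 4 (λ f n A B → f :* n :* B :* A := f :* (n :* (A :* B))) refl (fromℕ (t !)) (fromℕ (2 ℕ.+ t)) A B ⟩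
  fromℕ (t !) * (fromℕ (2 ℕ.+ t) * (A * B)) ∎
  where
  ps = permutations (2 ℕ.+ t)
  A = sum λ i → a i * a i
  B = sum λ v → b v * b v
  c = fromℕ (t !) * fromℕ (2 ℕ.+ t)
  T′ : Permutation′ (2 ℕ.+ t) → ℚ
  T′ p = T a b (p ⟨$⟩ʳ_)

  expand : ∀ i p → a i * b (p ⟨$⟩ʳ i) * T′ p ≡ a i * sum λ v → b v * (⟦ (p ⟨$⟩ʳ i) Fin.≟ v ⟧ * T′ p)
  expand i p = begin
    a i * b (p ⟨$⟩ʳ i) * T′ p      ≡⟨ ℚₚ.*-assoc (a i) (b (p ⟨$⟩ʳ i)) (T′ p) ⟩
    a i * (b (p ⟨$⟩ʳ i) * T′ p)    ≡⟨ cong (λ z → a i * (z * T′ p)) (sum-⟦⟧ (p ⟨$⟩ʳ i) b) ⟨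
    a i * (sum (λ v → ⟦ v Fin.≟ (p ⟨$⟩ʳ i) ⟧ * b v) * T′ p)
      ≡⟨ cong (a i *_) (*-distribʳ-sum (T′ p) (λ v → ⟦ v Fin.≟ (p ⟨$⟩ʳ i) ⟧ * b v)) ⟩
    a i * sum (λ v → ⟦ v Fin.≟ (p ⟨$⟩ʳ i) ⟧ * b v * T′ p)
      ≡⟨ cong (a i *_) (sum-cong-≗ λ v → trans
           (cong (λ z → z * b v * T′ p) (⟦⟧-⇔ (v Fin.≟ (p ⟨$⟩ʳ i)) ((p ⟨$⟩ʳ i) Fin.≟ v) sym sym))
           (solve 3 (λ x y z → x :* y :* z := y :* (x :* z)) refl ⟦ (p ⟨$⟩ʳ i) Fin.≟ v ⟧ (b v) (T′ p))) ⟩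
    a i * sum (λ v → b v * (⟦ (p ⟨$⟩ʳ i) Fin.≟ v ⟧ * T′ p)) ∎

  constant-injective : ∀ (i : Fin (2 ℕ.+ t)) → Inj {1} (λ _ → i)
  constant-injective i {zero} {zero} _ = refl

  pair : ∀ i v → ∑ ps (λ p → ⟦ (p ⟨$⟩ʳ i) Fin.≟ v ⟧ * T′ p) ≡ c * (a i * b v)
  pair i v = begin
    ∑ ps (λ p → ⟦ (p ⟨$⟩ʳ i) Fin.≟ v ⟧ * T′ p)
      ≡⟨ ∑-cong ps (λ p → cong (_* T′ p) (sym (ℚₚ.*-identityʳ ⟦ (p ⟨$⟩ʳ i) Fin.≟ v ⟧))) ⟩
    ∑ₚ (λ f → agree {1} (λ _ → i) (λ _ → v) f * T a b f)
      ≡⟨ ∑ₚ-agree-T 1 t (constant-injective i) (constant-injective v) a b ⟩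
    fromℕ (t !) * (fromℕ (suc t) * (a i * b v + 0ℚ) + (sum a - (a i + 0ℚ)) * (sum b - (b v + 0ℚ)))
      ≡⟨ cong₂ (λ x y → fromℕ (t !) * (fromℕ (suc t) * (a i * b v + 0ℚ) + (x - (a i + 0ℚ)) * (y - (b v + 0ℚ)))) a0 b0 ⟩
    fromℕ (t !) * (fromℕ (suc t) * (a i * b v + 0ℚ) + (0ℚ - (a i + 0ℚ)) * (0ℚ - (b v + 0ℚ)))
      -- As the scores sum to 0, the leftover sums are `- a i` and `- b v`. Their product adds one
      -- more copy of `a i * b v`, which turns the factor t + 1 into t + 2.
      ≡⟨ solve 4 (λ f s x y → f :* (s :* (x :* y :+ con 0ℚ) :+ (con 0ℚ :- (x :+ con 0ℚ)) :* (con 0ℚ :- (y :+ con 0ℚ))) :=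
                             f :* (con 1ℚ :+ s) :* (x :* y)) refl (fromℕ (t !)) (fromℕ (suc t)) (a i) (b v) ⟩
    fromℕ (t !) * (1ℚ + fromℕ (suc t)) * (a i * b v) ≡⟨ cong (λ z → fromℕ (t !) * z * (a i * b v)) (fromℕ-suc (suc t)) ⟨
    c * (a i * b v) ∎

module Covariance (L k t : ℕ) (q : Permutation′ k) where
  open Weight L

  n = k ℕ.+ suc t
  B = binomial k n

  -- This makes the contribution of the positions outside the copy disappear once all value sets are
  -- summed over.
  sum-tuple≡0 : ∑ (increasing k n) (λ is → sum (a ∘ lookup is)) ≡ 0ℚ
  sum-tuple≡0 = begin
    ∑ (increasing k n) (λ is → sum (a ∘ lookup is))       ≡⟨ ∑-sum-swap (increasing k n) (λ is → a ∘ lookup is) ⟩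
    sum (λ j → ∑ (increasing k n) λ is → a (lookup is j)) ≡⟨ sum-cong-≗ (∑-a k n) ⟩
    sum (λ (j : Fin k) → B * a j)                         ≡⟨ *-distribˡ-sum B (a {k}) ⟨
    B * sum (a {k})                                       ≡⟨ cong (B *_) (sum-a k) ⟩
    B * 0ℚ                                                ≡⟨ ℚₚ.*-zeroʳ B ⟩
    0ℚ                                                    ∎

  -- One factor `B` arises from averaging over position sets and one from averaging over value sets;
  -- what survives of the weights is their correlation along `q`.
  ∑ₚ-X-T : ∑ (permutations n) (λ p → X q n p * T a a (p ⟨$⟩ʳ_)) ≡
           fromℕ (t !) * (fromℕ (suc t) * (B * B * d q))
  ∑ₚ-X-T = begin
    ∑ ps (λ p → X q n p * T′ p)
      ≡⟨ ∑-cong ps (λ p → trans (cong (_* T′ p) (X-agree q p)) (sym (trans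
           (∑-cong I λ is → ∑-*ʳ I (T′ p) (λ us → match is us p))
           (∑-*ʳ I (T′ p) λ is → ∑ I λ us → match is us p)))) ⟩
    ∑ ps (λ p → ∑ I λ is → ∑ I λ us → match is us p * T′ p)
      ≡⟨ ∑-swap ps I (λ p is → ∑ I λ us → match is us p * T′ p) ⟩
    ∑ I (λ is → ∑ ps λ p → ∑ I λ us → match is us p * T′ p)
      ≡⟨ ∑-cong I (λ is → ∑-swap ps I (λ p us → match is us p * T′ p)) ⟩
    ∑ I (λ is → ∑ I λ us → ∑ ps λ p → match is us p * T′ p)
      ≡⟨ ∑-cong-∈ I (λ {is} is∈ → ∑-cong-∈ I λ {us} us∈ → trans
           (∑ₚ-agree-T k t (Increasing⇒Inj is (increasing⇒Increasing k n is∈))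
             (λ e → ⟨$⟩ʳ-injective q (Increasing⇒Inj us (increasing⇒Increasing k n us∈) e)) a a)
           (simplify is us)) ⟩
    ∑ I (λ is → ∑ I λ us → f * (s * P is us) + f * (S is * S us))
      ≡⟨ ∑-cong I (λ is → trans (∑-+ I (λ us → f * (s * P is us)) (λ us → f * (S is * S us)))
           (cong₂ _+_ (trans (∑-*ˡ I f (λ us → s * P is us)) (cong (f *_) (∑-*ˡ I s (P is))))
                      (trans (∑-*ˡ I f (λ us → S is * S us)) (cong (f *_) (trans (∑-*ˡ I (S is) S)
                        (trans (cong (S is *_) sum-tuple≡0) (ℚₚ.*-zeroʳ (S is)))))))) ⟩
    ∑ I (λ is → f * (s * ∑ I (P is)) + f * 0ℚ)
      ≡⟨ ∑-cong I (λ is → solve 3 (λ f s x → f :* (s :* x) :+ f :* con 0ℚ := f :* s :* x) refl f s (∑ I (P is))) ⟩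
    ∑ I (λ is → f * s * ∑ I (P is))  ≡⟨ ∑-*ˡ I (f * s) (λ is → ∑ I (P is)) ⟩
    f * s * ∑ I (λ is → ∑ I (P is))  ≡⟨ cong (f * s *_) products ⟩
    f * s * (B * B * d q)              ≡⟨ ℚₚ.*-assoc f s (B * B * d q) ⟩
    f * (s * (B * B * d q))            ∎
    where
    ps = permutations n
    I  = increasing k n
    f  = fromℕ (t !)
    s  = fromℕ (suc t)

    T′ : Permutation′ n → ℚ
    T′ p = T a a (p ⟨$⟩ʳ_)

    match : Vec (Fin n) k → Vec (Fin n) k → Permutation′ n → ℚ
    match is us p = agree (lookup is) (lookup us ∘ (q ⟨$⟩ʳ_)) (p ⟨$⟩ʳ_)

    P : Vec (Fin n) k → Vec (Fin n) k → ℚ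
    P is us = sum λ j → a (lookup is j) * a (lookup us (q ⟨$⟩ʳ j))

    S : Vec (Fin n) k → ℚ
    S is = sum (a ∘ lookup is)

    simplify : ∀ is us →
      f * (s * P is us + (sum (a {n}) - S is) * (sum (a {n}) - sum (a ∘ lookup us ∘ (q ⟨$⟩ʳ_)))) ≡
      f * (s * P is us) + f * (S is * S us)
    simplify is us = trans
      -- Reordering by `q` does not change the sum of the value weights, so the cross term splits
      -- into a factor in `is` and a factor in `us`.
      (cong₂ (λ x y → f * (s * P is us + (x - S is) * (x - y))) (sum-a n) (sym (sum-permute (a ∘ lookup us) q)))
      (solve 5 (λ f s p x y → f :* (s :* p :+ (con 0ℚ :- x) :* (con 0ℚ :- y)) := f :* (s :* p) :+ f :* (x :* y)) refl
        f s (P is us) (S is) (S us))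

    products : ∑ I (λ is → ∑ I (P is)) ≡ B * B * d q
    products = begin
      ∑ I (λ is → ∑ I (P is))
        ≡⟨ ∑-cong I (λ is → trans (∑-sum-swap I (λ us j → a (lookup is j) * a (lookup us (q ⟨$⟩ʳ j))))
             (sum-cong-≗ λ j → trans (∑-*ˡ I (a (lookup is j)) (λ us → a (lookup us (q ⟨$⟩ʳ j))))
               (cong (a (lookup is j) *_) (∑-a k n (q ⟨$⟩ʳ j))))) ⟩
      ∑ I (λ is → sum λ j → a (lookup is j) * (B * a (q ⟨$⟩ʳ j)))
        ≡⟨ ∑-sum-swap I (λ is j → a (lookup is j) * (B * a (q ⟨$⟩ʳ j))) ⟩
      sum (λ j → ∑ I λ is → a (lookup is j) * (B * a (q ⟨$⟩ʳ j)))
        ≡⟨ sum-cong-≗ (λ j → trans (∑-*ʳ I (B * a (q ⟨$⟩ʳ j)) (λ is → a (lookup is j)))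
             (trans (cong (_* (B * a (q ⟨$⟩ʳ j))) (∑-a k n j))
               (solve 3 (λ B x y → B :* x :* (B :* y) := B :* B :* (x :* y)) refl B (a j) (a (q ⟨$⟩ʳ j))))) ⟩
      sum (λ j → B * B * (a j * a (q ⟨$⟩ʳ j))) ≡⟨ *-distribˡ-sum (B * B) (λ j → a j * a (q ⟨$⟩ʳ j)) ⟨
      B * B * d q ∎

-- Non-degeneracy

-- From 4k ≤ L one gets k + L ≤ 5L / 4, and (5/4)² < 2. With L = 4k + r the difference of the two
-- sides is a polynomial with natural coefficients and positive constant term.
[k+L]²<2[1+L]² : ∀ k L → 4 ℕ.* k ℕ.≤ L → (k ℕ.+ L) ℕ.* (k ℕ.+ L) ℕ.< 2 ℕ.* (suc L ℕ.* suc L)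
[k+L]²<2[1+L]² k L 4k≤L = subst (λ L → (k ℕ.+ L) ℕ.* (k ℕ.+ L) ℕ.< 2 ℕ.* (suc L ℕ.* suc L))
  (ℕₚ.m+[n∸m]≡n 4k≤L) (bound (L ℕ.∸ 4 ℕ.* k))
  where
  identity : ∀ k r → 2 ℕ.* ((1 ℕ.+ (4 ℕ.* k ℕ.+ r)) ℕ.* (1 ℕ.+ (4 ℕ.* k ℕ.+ r))) ≡
    1 ℕ.+ (7 ℕ.* (k ℕ.* k) ℕ.+ 6 ℕ.* (k ℕ.* r) ℕ.+ r ℕ.* r ℕ.+ 16 ℕ.* k ℕ.+ 4 ℕ.* r ℕ.+ 1
           ℕ.+ (k ℕ.+ (4 ℕ.* k ℕ.+ r)) ℕ.* (k ℕ.+ (4 ℕ.* k ℕ.+ r)))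
  identity = solve-∀
  bound : ∀ r → let L = 4 ℕ.* k ℕ.+ r in (k ℕ.+ L) ℕ.* (k ℕ.+ L) ℕ.< 2 ℕ.* (suc L ℕ.* suc L)
  bound r = subst ((k ℕ.+ L′) ℕ.* (k ℕ.+ L′) ℕ.<_) (sym (identity k r)) (ℕ.s≤s (ℕₚ.m≤n+m _ _))
    where L′ = 4 ℕ.* k ℕ.+ r

-- This is k β² < h₀² with denominators cleared, where h₀ = k / (k + L) and β = 1 / (L + 1). For k =
-- 1 the two sides coincide; strictness uses k ≥ 2.
cube-bound₁ : ∀ m L → let k = suc (suc m) in k ℕ.* (k ℕ.* k) ≡ L →
  k ℕ.* ((k ℕ.+ L) ℕ.* (k ℕ.+ L)) ℕ.< k ℕ.* k ℕ.* (suc L ℕ.* suc L)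
cube-bound₁ m L k³≡L = subst (k ℕ.* ((k ℕ.+ L) ℕ.* (k ℕ.+ L)) ℕ.<_) (sym (ℕₚ.*-assoc k k (suc L ℕ.* suc L)))
  (ℕₚ.*-monoʳ-< k (ℕₚ.<-≤-trans ([k+L]²<2[1+L]² k L 4k≤L) (ℕₚ.*-monoˡ-≤ (suc L ℕ.* suc L) 2≤k)))
  where
  k = suc (suc m)
  2≤k : 2 ℕ.≤ k
  2≤k = ℕ.s≤s (ℕ.s≤s ℕ.z≤n)
  4k≤L : 4 ℕ.* k ℕ.≤ L
  4k≤L = subst₂ ℕ._≤_ (ℕₚ.*-comm k 4) k³≡L (ℕₚ.*-monoʳ-≤ k (ℕₚ.*-mono-≤ 2≤k 2≤k))

-- This is h₀ h₁ < β² with denominators cleared, where h₁ = h₀ (k - 1) / (k - 1 + L). The cube is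
-- chosen for this bound: k² (k - 1) ≤ k³ = L < k - 1 + L, and L + 1 ≤ k + L handles the squares.
cube-bound₂ : ∀ m L → let k = suc (suc m) in k ℕ.* (k ℕ.* k) ≡ L →
  k ℕ.* k ℕ.* suc m ℕ.* (suc L ℕ.* suc L) ℕ.< (k ℕ.+ L) ℕ.* (k ℕ.+ L) ℕ.* suc (m ℕ.+ L)
cube-bound₂ m L k³≡L = subst (k ℕ.* k ℕ.* suc m ℕ.* (suc L ℕ.* suc L) ℕ.<_) (ℕₚ.*-comm (suc (m ℕ.+ L)) ((k ℕ.+ L) ℕ.* (k ℕ.+ L)))
  (ℕₚ.≤-<-trans (ℕₚ.*-monoʳ-≤ (k ℕ.* k ℕ.* suc m) (ℕₚ.*-mono-≤ L′≤K L′≤K))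
    (ℕₚ.*-monoˡ-< ((k ℕ.+ L) ℕ.* (k ℕ.+ L)) small))
  where
  k = suc (suc m)
  L′≤K : suc L ℕ.≤ k ℕ.+ L
  L′≤K = ℕ.s≤s (ℕₚ.m≤n+m L (suc m))
  small : k ℕ.* k ℕ.* suc m ℕ.< suc (m ℕ.+ L)
  small = ℕ.s≤s (ℕₚ.≤-trans (subst (k ℕ.* k ℕ.* suc m ℕ.≤_) (trans (ℕₚ.*-comm (k ℕ.* k) k) k³≡L)
    (ℕₚ.*-monoʳ-≤ (k ℕ.* k) (ℕₚ.n≤1+n (suc m)))) (ℕₚ.m≤n+m L m))

fromℕ-mono-< : ∀ {m n} → m ℕ.< n → fromℕ m <ℚ fromℕ n
fromℕ-mono-< {m} m<n = ℚₚ.<-≤-trans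
  (subst₂ _<ℚ_ (ℚₚ.+-identityˡ (fromℕ m)) (sym (fromℕ-suc m)) (ℚₚ.+-monoˡ-< (fromℕ m) (0<fromℕ 0)))
  (fromℕ-mono-≤ m<n)

0<square : ∀ {p} → p ≢ 0ℚ → 0ℚ <ℚ p * p
0<square {p} p≢0 with ℚₚ.<-cmp 0ℚ p
... | tri< 0<p _ _ = 0<* 0<p 0<p
... | tri≈ _ 0≡p _ = contradiction (sym 0≡p) p≢0
... | tri> _ _ p<0 = subst (0ℚ <ℚ_) (solve 1 (λ p → (:- p) :* (:- p) := p :* p) refl p)
  (0<* (ℚₚ.neg-antimono-< p<0) (ℚₚ.neg-antimono-< p<0))

p-q≡0⇒p≡q : ∀ p q → p - q ≡ 0ℚ → p ≡ q
p-q≡0⇒p≡q p q e = begin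
  p          ≡⟨ solve 2 (λ p q → p := (p :- q) :+ q) refl p q ⟩
  p - q + q  ≡⟨ cong (_+ q) e ⟩
  0ℚ + q     ≡⟨ ℚₚ.+-identityˡ q ⟩
  q          ∎

-- L is a variable, as Agda would otherwise normalise polynomials in k³.
module NonDegenerate (m L : ℕ) (k³≡L : suc (suc m) ℕ.* (suc (suc m) ℕ.* suc (suc m)) ≡ L) where

  k K Y : ℕ
  k = suc (suc m)
  K = suc (suc m ℕ.+ L)
  Y = suc (m ℕ.+ L)

  k·K²<k²·[L+1]² : k ℕ.* (K ℕ.* K) ℕ.< k ℕ.* k ℕ.* (suc L ℕ.* suc L)
  k·K²<k²·[L+1]² = cube-bound₁ m L k³≡L

  k²·[k-1]·[L+1]²<K²·Y : k ℕ.* k ℕ.* suc m ℕ.* (suc L ℕ.* suc L) ℕ.< K ℕ.* K ℕ.* Y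
  k²·[k-1]·[L+1]²<K²·Y = cube-bound₂ m L k³≡L

  open Weight L
  open WeightBounds L

  -- The reciprocals of `K` = k + L and of `Y` = k - 1 + L, as `recip` inverts the successor of its
  -- argument.
  x y : ℚ
  x = recip (suc m ℕ.+ L)
  y = recip (m ℕ.+ L)

  h₀ h₁ : ℚ
  h₀ = h {k} zero
  h₁ = h {k} (suc zero)

  h₀≡ : h₀ ≡ fromℕ k * x
  h₀≡ = begin
    w (suc m) * (w⁻¹ (suc m) * (fromℕ k * x))  ≡⟨ ℚₚ.*-assoc (w (suc m)) (w⁻¹ (suc m)) (fromℕ k * x) ⟨
    w (suc m) * w⁻¹ (suc m) * (fromℕ k * x)    ≡⟨ cong (_* (fromℕ k * x)) (w-inverse (suc m)) ⟩
    1ℚ * (fromℕ k * x)                         ≡⟨ ℚₚ.*-identityˡ (fromℕ k * x) ⟩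
    fromℕ k * x                                ∎

  h₁≡ : h₁ ≡ fromℕ (suc m) * y * (fromℕ k * x)
  h₁≡ = begin
    w m * (w⁻¹ m * (fromℕ (suc m) * y) * (fromℕ k * x))
      ≡⟨ solve 4 (λ w v a b → w :* (v :* a :* b) := w :* v :* (a :* b)) refl (w m) (w⁻¹ m) (fromℕ (suc m) * y) (fromℕ k * x) ⟩
    w m * w⁻¹ m * (fromℕ (suc m) * y * (fromℕ k * x))
      ≡⟨ cong (_* (fromℕ (suc m) * y * (fromℕ k * x))) (w-inverse m) ⟩
    1ℚ * (fromℕ (suc m) * y * (fromℕ k * x))   ≡⟨ ℚₚ.*-identityˡ (fromℕ (suc m) * y * (fromℕ k * x)) ⟩
    fromℕ (suc m) * y * (fromℕ k * x)          ∎

  -- The reciprocal of (L + 1)² (k + L)². Multiplying the integer inequalities by it, or by `u * y`,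
  -- restores the denominators.
  u : ℚ
  u = β * x * (β * x)

  0<u : 0ℚ <ℚ u
  0<u = 0<* (0<* (0<recip L) (0<recip (suc m ℕ.+ L))) (0<* (0<recip L) (0<recip (suc m ℕ.+ L)))

  β·L′ : β * fromℕ (suc L) ≡ 1ℚ
  β·L′ = recip-inverse L

  x·K : x * fromℕ K ≡ 1ℚ
  x·K = recip-inverse (suc m ℕ.+ L)

  kβ²<h₀² : fromℕ k * (β * β) <ℚ h₀ * h₀
  kβ²<h₀² = subst₂ _<ℚ_ left right
    (ℚₚ.*-monoʳ-<-pos u {{positive 0<u}} (fromℕ-mono-< k·K²<k²·[L+1]²))
    where
    left : u * fromℕ (k ℕ.* (K ℕ.* K)) ≡ fromℕ k * (β * β)
    left = begin
      u * fromℕ (k ℕ.* (K ℕ.* K))           ≡⟨ cong (u *_) (trans (fromℕ-homo-* k (K ℕ.* K)) (cong (fromℕ k *_) (fromℕ-homo-* K K))) ⟩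
      u * (fromℕ k * (fromℕ K * fromℕ K))
        ≡⟨ solve 4 (λ b x k K → b :* x :* (b :* x) :* (k :* (K :* K)) := k :* (b :* b) :* ((x :* K) :* (x :* K))) refl β x (fromℕ k) (fromℕ K) ⟩
      fromℕ k * (β * β) * (x * fromℕ K * (x * fromℕ K)) ≡⟨ cong (λ z → fromℕ k * (β * β) * (z * z)) x·K ⟩
      fromℕ k * (β * β) * 1ℚ                ≡⟨ ℚₚ.*-identityʳ (fromℕ k * (β * β)) ⟩
      fromℕ k * (β * β)                     ∎
    right : u * fromℕ (k ℕ.* k ℕ.* (suc L ℕ.* suc L)) ≡ h₀ * h₀
    right = begin
      u * fromℕ (k ℕ.* k ℕ.* (suc L ℕ.* suc L))
        ≡⟨ cong (u *_) (trans (fromℕ-homo-* (k ℕ.* k) (suc L ℕ.* suc L)) (cong₂ _*_ (fromℕ-homo-* k k) (fromℕ-homo-* (suc L) (suc L)))) ⟩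
      u * (fromℕ k * fromℕ k * (fromℕ (suc L) * fromℕ (suc L)))
        ≡⟨ solve 4 (λ b x k l → b :* x :* (b :* x) :* (k :* k :* (l :* l)) := k :* x :* (k :* x) :* ((b :* l) :* (b :* l))) refl β x (fromℕ k) (fromℕ (suc L)) ⟩
      fromℕ k * x * (fromℕ k * x) * (β * fromℕ (suc L) * (β * fromℕ (suc L)))
        ≡⟨ cong₂ (λ z v → v * v * (z * z)) β·L′ (sym h₀≡) ⟩
      h₀ * h₀ * 1ℚ                          ≡⟨ ℚₚ.*-identityʳ (h₀ * h₀) ⟩
      h₀ * h₀                               ∎

  h₀h₁<β² : h₀ * h₁ <ℚ β * β
  h₀h₁<β² = subst₂ _<ℚ_ left right
    (ℚₚ.*-monoʳ-<-pos (u * y) {{positive (0<* 0<u (0<recip (m ℕ.+ L)))}} (fromℕ-mono-< k²·[k-1]·[L+1]²<K²·Y))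
    where
    left : u * y * fromℕ (k ℕ.* k ℕ.* suc m ℕ.* (suc L ℕ.* suc L)) ≡ h₀ * h₁
    left = begin
      u * y * fromℕ (k ℕ.* k ℕ.* suc m ℕ.* (suc L ℕ.* suc L))
        ≡⟨ cong (u * y *_) (trans (fromℕ-homo-* (k ℕ.* k ℕ.* suc m) (suc L ℕ.* suc L))
             (cong₂ _*_ (trans (fromℕ-homo-* (k ℕ.* k) (suc m)) (cong (_* fromℕ (suc m)) (fromℕ-homo-* k k)))
                        (fromℕ-homo-* (suc L) (suc L)))) ⟩
      u * y * (fromℕ k * fromℕ k * fromℕ (suc m) * (fromℕ (suc L) * fromℕ (suc L)))
        ≡⟨ solve 6 (λ b x y k p l → b :* x :* (b :* x) :* y :* (k :* k :* p :* (l :* l)) :=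
             k :* x :* (p :* y :* (k :* x)) :* ((b :* l) :* (b :* l))) refl β x y (fromℕ k) (fromℕ (suc m)) (fromℕ (suc L)) ⟩
      fromℕ k * x * (fromℕ (suc m) * y * (fromℕ k * x)) * (β * fromℕ (suc L) * (β * fromℕ (suc L)))
        ≡⟨ cong₂ (λ z v → v * (z * z)) β·L′ (cong₂ _*_ (sym h₀≡) (sym h₁≡)) ⟩
      h₀ * h₁ * 1ℚ                          ≡⟨ ℚₚ.*-identityʳ (h₀ * h₁) ⟩
      h₀ * h₁                               ∎
    right : u * y * fromℕ (K ℕ.* K ℕ.* Y) ≡ β * β
    right = begin
      u * y * fromℕ (K ℕ.* K ℕ.* Y)
        ≡⟨ cong (u * y *_) (trans (fromℕ-homo-* (K ℕ.* K) Y) (cong (_* fromℕ Y) (fromℕ-homo-* K K))) ⟩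
      u * y * (fromℕ K * fromℕ K * fromℕ Y)
        ≡⟨ solve 5 (λ b x y K Y → b :* x :* (b :* x) :* y :* (K :* K :* Y) := b :* b :* ((x :* K) :* (x :* K) :* (y :* Y))) refl β x y (fromℕ K) (fromℕ Y) ⟩
      β * β * (x * fromℕ K * (x * fromℕ K) * (y * fromℕ Y))
        ≡⟨ cong₂ (λ z v → β * β * (z * z * v)) x·K (recip-inverse (m ℕ.+ L)) ⟩
      β * β * 1ℚ                            ≡⟨ ℚₚ.*-identityʳ (β * β) ⟩
      β * β                                 ∎

  module _ (q : Permutation′ k) where

    D : ℚ
    D = sum λ (j : Fin k) → h j * h (q ⟨$⟩ʳ j)

    -- The usual covariance identity: the values `h j` have mean β over the k positions, and
    -- permuting by `q` leaves the sum of the `a j` at 0.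
    d≡D-kβ² : d q ≡ D - fromℕ k * (β * β)
    d≡D-kβ² = begin
      sum (λ (j : Fin k) → (h j - β) * (h (q ⟨$⟩ʳ j) - β))
        ≡⟨ sum-cong-≗ (λ (j : Fin k) → solve 3 (λ x y b → (x :- b) :* (y :- b) := x :* y :+ ((:- b) :* x :+ (:- b) :* (y :- b)))
             refl (h j) (h (q ⟨$⟩ʳ j)) β) ⟩
      sum (λ (j : Fin k) → h j * h (q ⟨$⟩ʳ j) + (- β * h j + - β * a (q ⟨$⟩ʳ j)))
        ≡⟨ trans (∑-distrib-+ (λ (j : Fin k) → h j * h (q ⟨$⟩ʳ j)) (λ j → - β * h j + - β * a (q ⟨$⟩ʳ j)))
             (cong (D +_) (trans (∑-distrib-+ (λ (j : Fin k) → - β * h j) (λ j → - β * a (q ⟨$⟩ʳ j)))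
               (cong₂ _+_ (sym (*-distribˡ-sum (- β) (h {k}))) (sym (*-distribˡ-sum (- β) λ j → a (q ⟨$⟩ʳ j)))))) ⟩
      D + (- β * sum (h {k}) + - β * sum (λ j → a (q ⟨$⟩ʳ j)))
        ≡⟨ cong₂ (λ x y → D + (- β * x + - β * y)) (sum-h k) (trans (sym (sum-permute (a {k}) q)) (sum-a k)) ⟩
      D + (- β * (fromℕ k * β) + - β * 0ℚ)
        ≡⟨ solve 3 (λ D b k → D :+ ((:- b) :* (k :* b) :+ (:- b) :* con 0ℚ) := D :- k :* (b :* b)) refl D β (fromℕ k) ⟩
      D - fromℕ k * (β * β) ∎

    -- If `q` starts with its least entry, the first term of `D` is h₀² and already exceeds k β².
    -- Otherwise no term pairs the first position with the least value, so each of the k terms is at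
    -- most h₀ h₁ < β².
    D≢kβ² : ∀ v → q ⟨$⟩ʳ zero ≡ v → D ≢ fromℕ k * (β * β)
    D≢kβ² zero q₀ e = ℚₚ.<⇒≢ (ℚₚ.<-≤-trans kβ²<h₀² h₀²≤D) (sym e)
      where
      0≤tail : 0ℚ ≤ℚ sum λ j → h (Fin.suc j) * h (q ⟨$⟩ʳ suc j)
      0≤tail = subst (_≤ℚ sum λ j → h (Fin.suc j) * h (q ⟨$⟩ʳ suc j)) (sum-replicate-zero (suc m))
        (sum-mono λ j → 0≤* (0≤h (Fin.suc j)) (0≤h (q ⟨$⟩ʳ suc j)))
      h₀²≤D : h₀ * h₀ ≤ℚ D
      h₀²≤D = subst₂ _≤ℚ_ (ℚₚ.+-identityʳ (h₀ * h₀))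
        (cong (λ v → h₀ * h v + sum λ j → h (Fin.suc j) * h (q ⟨$⟩ʳ suc j)) (sym q₀))
        (ℚₚ.+-monoʳ-≤ (h₀ * h₀) 0≤tail)
    D≢kβ² (suc l) q₀ e = ℚₚ.<⇒≢ (ℚₚ.≤-<-trans D≤kh₀h₁ kh₀h₁<kβ²) e
      where
      h-suc≤h₁ : ∀ j → h {k} (suc j) ≤ℚ h₁
      h-suc≤h₁ j = h-mono {k} {suc j} {suc zero} (ℕ.s≤s⁻¹ (after< j))
      h≤h₀ : ∀ j → h {k} j ≤ℚ h₀
      h≤h₀ j = h-mono {k} {j} {zero} (ℕ.s≤s⁻¹ (after< j))
      -- One of the two indices `j` and `q ⟨$⟩ʳ j` is always a successor and contributes at most
      -- `h₁`; the other contributes at most `h₀`.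
      term : ∀ j → h j * h (q ⟨$⟩ʳ j) ≤ℚ h₀ * h₁
      term zero    = ℚₚ.*-monoˡ-≤-nonNeg h₀ {{nonNegative (0≤h {k} zero)}}
        (subst (λ v → h v ≤ℚ h₁) (sym q₀) (h-suc≤h₁ l))
      term (suc j) = subst (h (Fin.suc j) * h (q ⟨$⟩ʳ suc j) ≤ℚ_) (ℚₚ.*-comm h₁ h₀)
        (*-mono-≤ (0≤h {k} (suc j)) (0≤h {k} zero) (h-suc≤h₁ j) (h≤h₀ (q ⟨$⟩ʳ suc j)))
      D≤kh₀h₁ : D ≤ℚ fromℕ k * (h₀ * h₁)
      D≤kh₀h₁ = subst (D ≤ℚ_) (sum-const k (h₀ * h₁)) (sum-mono {k} term)
      kh₀h₁<kβ² : fromℕ k * (h₀ * h₁) <ℚ fromℕ k * (β * β)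
      kh₀h₁<kβ² = ℚₚ.*-monoʳ-<-pos (fromℕ k) {{positive (0<fromℕ (suc m))}} h₀h₁<β²

    d≢0 : d q ≢ 0ℚ
    d≢0 d≡0 = D≢kβ² (q ⟨$⟩ʳ zero) refl
      (p-q≡0⇒p≡q D (fromℕ k * (β * β)) (trans (sym d≡D-kβ²) d≡0))

-- Moments and the variance bound

factorial-binomial : ∀ k t → fromℕ (k !) * (fromℕ (t !) * binomial k (k ℕ.+ t)) ≡ fromℕ ((k ℕ.+ t) !)
factorial-binomial zero    t = solve 1 (λ x → con 1ℚ :* (x :* con 1ℚ) := x) refl (fromℕ (t !))
factorial-binomial (suc k) t = begin
  fromℕ (suc k !) * (T! * B)             ≡⟨ cong (_* (T! * B)) (fromℕ-homo-* (suc k) (k !)) ⟩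
  fromℕ (suc k) * fromℕ (k !) * (T! * B) ≡⟨ solve 4 (λ s k t b → s :* k :* (t :* b) := k :* t :* (s :* b)) refl (fromℕ (suc k)) (fromℕ (k !)) T! B ⟩
  fromℕ (k !) * T! * (fromℕ (suc k) * B) ≡⟨ cong (fromℕ (k !) * T! *_) (absorption k (k ℕ.+ t)) ⟩
  fromℕ (k !) * T! * (fromℕ (suc (k ℕ.+ t)) * B′)
    ≡⟨ solve 4 (λ k t s b → k :* t :* (s :* b) := s :* (k :* (t :* b))) refl (fromℕ (k !)) T! (fromℕ (suc (k ℕ.+ t))) B′ ⟩
  fromℕ (suc (k ℕ.+ t)) * (fromℕ (k !) * (T! * B′)) ≡⟨ cong (fromℕ (suc (k ℕ.+ t)) *_) (factorial-binomial k t) ⟩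
  fromℕ (suc (k ℕ.+ t)) * fromℕ ((k ℕ.+ t) !) ≡⟨ fromℕ-homo-* (suc (k ℕ.+ t)) ((k ℕ.+ t) !) ⟨
  fromℕ (suc (k ℕ.+ t) !)                ∎
  where
  T! = fromℕ (t !)
  B  = binomial (suc k) (suc (k ℕ.+ t))
  B′ = binomial k (k ℕ.+ t)

-- The right side is the product (t + 1)(t + 2) ... (t + k), all of whose factors are at least t +
-- 1.
binomial-≥-power : ∀ k t → fromℕ (suc t ℕ.^ k) ≤ℚ fromℕ (k !) * binomial k (k ℕ.+ t)
binomial-≥-power zero    t = ℚₚ.≤-refl
binomial-≥-power (suc k) t = subst₂ _≤ℚ_ (sym (fromℕ-homo-* (suc t) (suc t ℕ.^ k))) step
  (*-mono-≤ (0≤fromℕ (suc t)) (ℚₚ.≤-trans (0≤fromℕ (suc t ℕ.^ k)) (binomial-≥-power k t))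
    (fromℕ-mono-≤ (ℕ.s≤s (ℕₚ.m≤n+m t k))) (binomial-≥-power k t))
  where
  B  = binomial (suc k) (suc (k ℕ.+ t))
  B′ = binomial k (k ℕ.+ t)
  step : fromℕ (suc (k ℕ.+ t)) * (fromℕ (k !) * B′) ≡ fromℕ (suc k !) * B
  step = begin
    fromℕ (suc (k ℕ.+ t)) * (fromℕ (k !) * B′) ≡⟨ solve 3 (λ s k b → s :* (k :* b) := k :* (s :* b)) refl (fromℕ (suc (k ℕ.+ t))) (fromℕ (k !)) B′ ⟩
    fromℕ (k !) * (fromℕ (suc (k ℕ.+ t)) * B′) ≡⟨ cong (fromℕ (k !) *_) (absorption k (k ℕ.+ t)) ⟨
    fromℕ (k !) * (fromℕ (suc k) * B)          ≡⟨ solve 3 (λ k s b → k :* (s :* b) := s :* k :* b) refl (fromℕ (k !)) (fromℕ (suc k)) B ⟩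
    fromℕ (suc k) * fromℕ (k !) * B            ≡⟨ cong (_* B) (fromℕ-homo-* (suc k) (k !)) ⟨
    fromℕ (suc k !) * B                        ∎

^-distribʳ-* : ∀ m n k → (m ℕ.* n) ℕ.^ k ≡ m ℕ.^ k ℕ.* n ℕ.^ k
^-distribʳ-* m n zero    = refl
^-distribʳ-* m n (suc k) = trans (cong (m ℕ.* n ℕ.*_) (^-distribʳ-* m n k)) (interchange m n (m ℕ.^ k) (n ℕ.^ k))
  where
  interchange : ∀ a b c d → a ℕ.* b ℕ.* (c ℕ.* d) ≡ a ℕ.* c ℕ.* (b ℕ.* d)
  interchange = solve-∀

inv : ∀ n → .{{ℕ.NonZero n}} → ℚ
inv n = ℤ.+ 1 / n

0<inv : ∀ n .{{_ : ℕ.NonZero n}} → 0ℚ <ℚ inv n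
0<inv (suc n) = 0<recip n

power-bound : ∀ k t .{{_ : ℕ.NonZero k}} → (k ℕ.+ t) ℕ.^ k ℕ.≤ k ℕ.^ k ℕ.* suc t ℕ.^ k
power-bound k@(suc m) t = subst ((k ℕ.+ t) ℕ.^ k ℕ.≤_) (^-distribʳ-* k (suc t) k)
  (ℕₚ.^-monoˡ-≤ k (subst (k ℕ.+ t ℕ.≤_) (sym (ℕₚ.*-suc k t)) (ℕₚ.+-monoʳ-≤ k (ℕₚ.m≤n*m t k))))

-- The constant in C(n, k) ≥ γ nᵏ for n = k + t: here k! C(n, k) ≥ (t + 1)ᵏ, and n ≤ k (t + 1) costs
-- the factor kᵏ.
γ : ∀ k → .{{ℕ.NonZero k}} → ℚ
γ k = inv (k !) {{k ℕₚ.!≢0}} * inv (k ℕ.^ k) {{ℕₚ.m^n≢0 k k}}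

0<γ : ∀ k .{{_ : ℕ.NonZero k}} → 0ℚ <ℚ γ k
0<γ k = 0<* (0<inv (k !) {{k ℕₚ.!≢0}}) (0<inv (k ℕ.^ k) {{ℕₚ.m^n≢0 k k}})

γnᵏ≤binomial : ∀ k t .{{_ : ℕ.NonZero k}} → γ k * fromℕ ((k ℕ.+ t) ℕ.^ k) ≤ℚ binomial k (k ℕ.+ t)
γnᵏ≤binomial k t = ℚₚ.≤-trans
  (ℚₚ.*-monoˡ-≤-nonNeg (γ k) {{nonNegative (ℚₚ.<⇒≤ (0<γ k))}}
    (ℚₚ.≤-trans (fromℕ-mono-≤ (power-bound k t))
      (subst (_≤ℚ fromℕ (k ℕ.^ k) * (fromℕ (k !) * B)) (sym (fromℕ-homo-* (k ℕ.^ k) (suc t ℕ.^ k)))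
        (ℚₚ.*-monoˡ-≤-nonNeg (fromℕ (k ℕ.^ k)) {{nonNegative (0≤fromℕ (k ℕ.^ k))}} (binomial-≥-power k t)))))
  (ℚₚ.≤-reflexive (begin
    i! * iᵏ * (fromℕ (k ℕ.^ k) * (fromℕ (k !) * B))
      ≡⟨ solve 5 (λ i j p f b → i :* j :* (p :* (f :* b)) := (i :* f) :* (j :* p) :* b) refl i! iᵏ (fromℕ (k ℕ.^ k)) (fromℕ (k !)) B ⟩
    i! * fromℕ (k !) * (iᵏ * fromℕ (k ℕ.^ k)) * B
      ≡⟨ cong₂ (λ x y → x * y * B) (1/n*n≡1 (k !) {{k ℕₚ.!≢0}}) (1/n*n≡1 (k ℕ.^ k) {{ℕₚ.m^n≢0 k k}}) ⟩
    1ℚ * 1ℚ * B   ≡⟨ ℚₚ.*-identityˡ B ⟩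
    B             ∎))
  where
  B  = binomial k (k ℕ.+ t)
  i! = inv (k !) {{k ℕₚ.!≢0}}
  iᵏ = inv (k ℕ.^ k) {{ℕₚ.m^n≢0 k k}}

module _ {n : ℕ} where

  private
    ps = permutations n
    e  = inv (n !) {{n ℕₚ.!≢0}}

    0≤e : 0ℚ ≤ℚ e
    0≤e = ℚₚ.<⇒≤ (0<inv (n !) {{n ℕₚ.!≢0}})

  𝔼-mono : ∀ {F G : Permutation′ n → ℚ} → (∀ p → F p ≤ℚ G p) → 𝔼 F ≤ℚ 𝔼 G
  𝔼-mono F≤G = ℚₚ.*-monoˡ-≤-nonNeg e {{nonNegative 0≤e}} (∑-mono ps F≤G)

  𝔼-+ : ∀ (F G : Permutation′ n → ℚ) → 𝔼 (λ p → F p + G p) ≡ 𝔼 F + 𝔼 G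
  𝔼-+ F G = trans (cong (e *_) (∑-+ ps F G)) (ℚₚ.*-distribˡ-+ e (∑ ps F) (∑ ps G))

  𝔼-* : ∀ c (F : Permutation′ n → ℚ) → 𝔼 (λ p → c * F p) ≡ c * 𝔼 F
  𝔼-* c F = trans (cong (e *_) (∑-*ˡ ps c F))
    (solve 3 (λ e c s → e :* (c :* s) := c :* (e :* s)) refl e c (∑ ps F))

  -- Expand 0 ≤ 𝔼 (Y − 𝔼 Y − s Z)².
  Var-lower-bound : ∀ (Y Z : Permutation′ n → ℚ) s → 𝔼 Z ≡ 0ℚ →
    (s + s) * 𝔼 (λ p → Y p * Z p) - s * s * 𝔼 (λ p → Z p * Z p) ≤ℚ Var Y
  Var-lower-bound Y Z s 𝔼Z≡0 = subst (_≤ℚ Var Y) expectation (𝔼-mono pointwise)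
    where
    μ = 𝔼 Y
    lower : Permutation′ n → ℚ
    lower p = (s + s) * (Y p * Z p) + ((- ((s + s) * μ)) * Z p + (- (s * s)) * (Z p * Z p))

    pointwise : ∀ p → lower p ≤ℚ (Y p - μ) * (Y p - μ)
    pointwise p = 0≤q-p⇒p≤q (subst (0ℚ ≤ℚ_)
      (solve 4 (λ y z s m → (y :- m :- s :* z) :* (y :- m :- s :* z) :=
        (y :- m) :* (y :- m) :- ((s :+ s) :* (y :* z) :+ ((:- ((s :+ s) :* m)) :* z :+ (:- (s :* s)) :* (z :* z))))
        refl (Y p) (Z p) s μ)
      (0≤square (Y p - μ - s * Z p)))

    expectation : 𝔼 lower ≡ (s + s) * 𝔼 (λ p → Y p * Z p) - s * s * 𝔼 (λ p → Z p * Z p)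
    expectation = begin
      𝔼 lower
        ≡⟨ trans (𝔼-+ (λ p → (s + s) * (Y p * Z p)) (λ p → (- ((s + s) * μ)) * Z p + (- (s * s)) * (Z p * Z p)))
             (cong₂ _+_ (𝔼-* (s + s) (λ p → Y p * Z p))
               (trans (𝔼-+ (λ p → (- ((s + s) * μ)) * Z p) (λ p → (- (s * s)) * (Z p * Z p)))
                 (cong₂ _+_ (𝔼-* (- ((s + s) * μ)) Z) (𝔼-* (- (s * s)) (λ p → Z p * Z p))))) ⟩
      (s + s) * C + ((- ((s + s) * μ)) * 𝔼 Z + (- (s * s)) * V)
        ≡⟨ cong (λ z → (s + s) * C + ((- ((s + s) * μ)) * z + (- (s * s)) * V)) 𝔼Z≡0 ⟩
      (s + s) * C + ((- ((s + s) * μ)) * 0ℚ + (- (s * s)) * V)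
        ≡⟨ solve 4 (λ s m C V → (s :+ s) :* C :+ ((:- ((s :+ s) :* m)) :* con 0ℚ :+ (:- (s :* s)) :* V) := (s :+ s) :* C :- s :* s :* V)
             refl s μ C V ⟩
      (s + s) * C - s * s * V ∎
      where
      C = 𝔼 λ p → Y p * Z p
      V = 𝔼 λ p → Z p * Z p

-- Moments of the test statistic

module TestStatistic (L : ℕ) where
  open Weight L
  open WeightBounds L

  Z : ∀ {n} → Permutation′ n → ℚ
  Z p = T a a (p ⟨$⟩ʳ_)

  𝔼-Z : ∀ t → 𝔼 (Z {suc t}) ≡ 0ℚ
  𝔼-Z t = trans (cong (e *_) (trans (∑ₚ-T t a a) (trans (cong (λ z → fromℕ (t !) * (z * z)) (sum-a (suc t)))
      (ℚₚ.*-zeroʳ (fromℕ (t !)))))) (ℚₚ.*-zeroʳ e)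
    where e = inv (suc t !) {{suc t ℕₚ.!≢0}}

  -- With n = 2 + t, `r` is 1 / (n - 1). Bounding both sums of squares by n leaves n² / (n - 1), and
  -- n / (n - 1) = 1 + 1 / (n - 1) ≤ 2.
  𝔼-Z² : ∀ t → 𝔼 (λ (p : Permutation′ (2 ℕ.+ t)) → Z p * Z p) ≤ℚ (1ℚ + 1ℚ) * fromℕ (2 ℕ.+ t)
  𝔼-Z² t = ℚₚ.≤-trans (ℚₚ.≤-reflexive exact) (ℚₚ.≤-trans
      (ℚₚ.*-monoˡ-≤-nonNeg r {{nonNegative 0≤r}} (*-mono-≤ 0≤A (0≤fromℕ n) (sum-a²≤n n) (sum-a²≤n n)))
      (subst₂ _≤ℚ_ (ℚₚ.*-assoc r N N) refl (ℚₚ.*-monoʳ-≤-nonNeg N {{nonNegative (0≤fromℕ n)}} rN≤2)))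
    where
    n = 2 ℕ.+ t
    N = fromℕ n
    M = fromℕ (suc t)
    r = recip t
    e = inv (n !) {{n ℕₚ.!≢0}}
    f = fromℕ (t !)
    A = sum λ (i : Fin n) → a i * a i
    0≤r = ℚₚ.<⇒≤ (0<recip t)
    0≤A : 0ℚ ≤ℚ A
    0≤A = subst (_≤ℚ A) (sum-replicate-zero n) (sum-mono {n} λ i → 0≤square (a i))

    efNM≡1 : e * (f * N * M) ≡ 1ℚ
    efNM≡1 = begin
      e * (f * N * M)             ≡⟨ cong (e *_) (solve 3 (λ f N M → f :* N :* M := N :* (M :* f)) refl f N M) ⟩
      e * (N * (M * f))           ≡⟨ cong (λ z → e * (N * z)) (fromℕ-homo-* (suc t) (t !)) ⟨
      e * (N * fromℕ (suc t !))   ≡⟨ cong (e *_) (fromℕ-homo-* n (suc t !)) ⟨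
      e * fromℕ (n !)             ≡⟨ 1/n*n≡1 (n !) {{n ℕₚ.!≢0}} ⟩
      1ℚ                          ∎

    exact : 𝔼 (λ (p : Permutation′ n) → Z p * Z p) ≡ r * (A * A)
    exact = begin
      e * ∑ (permutations n) (λ p → Z p * Z p) ≡⟨ cong (e *_) (∑ₚ-T-square t a a (sum-a n) (sum-a n)) ⟩
      e * (f * (N * (A * A)))                  ≡⟨ ℚₚ.*-identityʳ (e * (f * (N * (A * A)))) ⟨
      e * (f * (N * (A * A))) * 1ℚ             ≡⟨ cong (e * (f * (N * (A * A))) *_) (recip-inverse t) ⟨
      e * (f * (N * (A * A))) * (r * M)
        ≡⟨ solve 6 (λ e f N A r M → e :* (f :* (N :* (A :* A))) :* (r :* M) := e :* (f :* N :* M) :* (r :* (A :* A))) refl e f N A r M ⟩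
      e * (f * N * M) * (r * (A * A))          ≡⟨ cong (_* (r * (A * A))) efNM≡1 ⟩
      1ℚ * (r * (A * A))                       ≡⟨ ℚₚ.*-identityˡ (r * (A * A)) ⟩
      r * (A * A)                              ∎

    rN≤2 : r * N ≤ℚ 1ℚ + 1ℚ
    rN≤2 = subst₂ _≤ℚ_
      (sym (trans (cong (r *_) (fromℕ-suc (suc t))) (trans (ℚₚ.*-distribˡ-+ r 1ℚ M)
        (cong₂ _+_ (ℚₚ.*-identityʳ r) (recip-inverse t))))) refl
      (ℚₚ.+-monoˡ-≤ 1ℚ (recip≤1 t))

  -- Since k! (n - k)! C(n, k) = n!, one of the two binomial factors of `∑ₚ-X-T` cancels against 1 /
  -- n! and leaves 1 / k!.
  𝔼-X-Z : ∀ k t (q : Permutation′ k) → let n = k ℕ.+ suc t in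
    𝔼 (λ (p : Permutation′ n) → X q n p * Z p) ≡
    inv (k !) {{k ℕₚ.!≢0}} * (binomial k n * d q)
  𝔼-X-Z k t q = begin
    e * ∑ (permutations n) (λ p → X q n p * Z p) ≡⟨ cong (e *_) ∑ₚ-X-T ⟩
    e * (f * (s * (B * B * d q)))                  ≡⟨ ℚₚ.*-identityˡ (e * (f * (s * (B * B * d q)))) ⟨
    1ℚ * (e * (f * (s * (B * B * d q))))           ≡⟨ cong (_* (e * (f * (s * (B * B * d q))))) (1/n*n≡1 (k !) {{k ℕₚ.!≢0}}) ⟨
    i! * k! * (e * (f * (s * (B * B * d q))))
      ≡⟨ solve 7 (λ i k e f s B d → i :* k :* (e :* (f :* (s :* (B :* B :* d)))) := e :* (k :* (s :* f :* B)) :* (i :* (B :* d)))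
           refl i! k! e f s B (d q) ⟩
    e * (k! * (s * f * B)) * (i! * (B * d q))
      ≡⟨ cong (λ z → e * z * (i! * (B * d q)))
           (trans (cong (λ z → k! * (z * B)) (sym (fromℕ-homo-* (suc t) (t !)))) (factorial-binomial k (suc t))) ⟩
    e * fromℕ (n !) * (i! * (B * d q))             ≡⟨ cong (_* (i! * (B * d q))) (1/n*n≡1 (n !) {{n ℕₚ.!≢0}}) ⟩
    1ℚ * (i! * (B * d q))                          ≡⟨ ℚₚ.*-identityˡ (i! * (B * d q)) ⟩
    i! * (B * d q)                                 ∎
    where
    open Covariance L k t q
    e  = inv (n !) {{n ℕₚ.!≢0}}
    f  = fromℕ (t !)
    s  = fromℕ (suc t)
    k! = fromℕ (k !)
    i! = inv (k !) {{k ℕₚ.!≢0}}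

-- The explicit constant

½ : ℚ
½ = recip 1

module LowerBound (m L : ℕ) (q : Permutation′ (2 ℕ.+ m)) (d≢0 : Weight.d L q ≢ 0ℚ) where
  open Weight L using (d)
  open TestStatistic L

  k : ℕ
  k = 2 ℕ.+ m

  -- `i!` is 1 / k!. The constant arises from ½ (C(n, k) d / k!)² / n on replacing C(n, k) by γ nᵏ;
  -- it depends on `q` and `L` but not on n.
  i! c : ℚ
  i! = inv (k !) {{k ℕₚ.!≢0}}
  c = ½ * (i! * i!) * (d q * d q) * (γ k * γ k)

  0<c : 0ℚ <ℚ c
  0<c = 0<* (0<* (0<* (0<recip 1) (0<* 0<i! 0<i!)) (0<square d≢0)) (0<* (0<γ k) (0<γ k))
    where 0<i! = 0<inv (k !) {{k ℕₚ.!≢0}}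

  module _ (t : ℕ) where

    n : ℕ
    n = k ℕ.+ suc t

    B N ν x s : ℚ
    B = binomial k n
    N = fromℕ n
    ν = recip (suc (m ℕ.+ suc t))
    x = i! * (B * d q)
    s = ½ * x * ν

    νN≡1 : ν * N ≡ 1ℚ
    νN≡1 = recip-inverse (suc (m ℕ.+ suc t))

    0≤ν : 0ℚ ≤ℚ ν
    0≤ν = ℚₚ.<⇒≤ (0<recip (suc (m ℕ.+ suc t)))

    -- s maximises the quadratic (s + s) x - s² (2 N).
    ½x²ν≤Var : ½ * (x * x) * ν ≤ℚ Var (X q n)
    ½x²ν≤Var = ℚₚ.≤-trans
      (ℚₚ.≤-trans (ℚₚ.≤-reflexive (sym optimum))
        (ℚₚ.+-monoʳ-≤ ((s + s) * x) (ℚₚ.neg-antimono-≤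
          (ℚₚ.*-monoˡ-≤-nonNeg (s * s) {{nonNegative (0≤square s)}} (𝔼-Z² (m ℕ.+ suc t))))))
      (subst (λ C → (s + s) * C - s * s * 𝔼 (λ (p : Permutation′ n) → Z p * Z p) ≤ℚ Var (X q n))
        (𝔼-X-Z k t q)
        (Var-lower-bound (X q n) Z s (𝔼-Z (suc (m ℕ.+ suc t)))))
      where
      optimum : (s + s) * x - s * s * ((1ℚ + 1ℚ) * N) ≡ ½ * (x * x) * ν
      optimum = begin
        (s + s) * x - s * s * ((1ℚ + 1ℚ) * N)
          ≡⟨ solve 3 (λ x v N → let h = con ½; s = h :* x :* v in
               (s :+ s) :* x :- s :* s :* ((con 1ℚ :+ con 1ℚ) :* N) := x :* x :* v :- h :* (x :* x) :* v :* (v :* N)) refl x ν N ⟩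
        x * x * ν - ½ * (x * x) * ν * (ν * N)
          ≡⟨ cong (λ z → x * x * ν - ½ * (x * x) * ν * z) νN≡1 ⟩
        x * x * ν - ½ * (x * x) * ν * 1ℚ
          ≡⟨ solve 2 (λ x v → x :* x :* v :- con ½ :* (x :* x) :* v :* con 1ℚ := con ½ :* (x :* x) :* v) refl x ν ⟩
        ½ * (x * x) * ν ∎

    power : fromℕ (n ℕ.^ k) * fromℕ (n ℕ.^ k) * ν ≡ fromℕ (n ℕ.^ (2 ℕ.* k ℕ.∸ 1))
    power = begin
      fromℕ (n ℕ.^ k) * fromℕ (n ℕ.^ k) * ν    ≡⟨ cong (_* ν) (fromℕ-homo-* (n ℕ.^ k) (n ℕ.^ k)) ⟨
      fromℕ (n ℕ.^ k ℕ.* n ℕ.^ k) * ν          ≡⟨ cong (λ z → fromℕ z * ν) (trans (sym (ℕₚ.^-distribˡ-+-* n k k))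
                                                    (cong (λ l → n ℕ.^ (k ℕ.+ l)) (sym (ℕₚ.+-identityʳ k)))) ⟩
      -- As k = 2 + m, `2 ℕ.* k` computes to a successor: the subtraction does not truncate, and one
      -- factor n splits off the power by definition.
      fromℕ (n ℕ.* n ℕ.^ (2 ℕ.* k ℕ.∸ 1)) * ν  ≡⟨ cong (_* ν) (fromℕ-homo-* n (n ℕ.^ (2 ℕ.* k ℕ.∸ 1))) ⟩
      N * P * ν                                ≡⟨ solve 3 (λ N P v → N :* P :* v := v :* N :* P) refl N P ν ⟩
      ν * N * P                                ≡⟨ cong (_* P) νN≡1 ⟩
      1ℚ * P                                   ≡⟨ ℚₚ.*-identityˡ P ⟩
      P                                        ∎
      where P = fromℕ (n ℕ.^ (2 ℕ.* k ℕ.∸ 1))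

    c·n²ᵏ⁻¹≤Var : c * fromℕ (n ℕ.^ (2 ℕ.* k ℕ.∸ 1)) ≤ℚ Var (X q n)
    -- Squaring γ nᵏ ≤ C(n, k) gives n to the power 2k, and the factor 1 / n in `g` lowers the
    -- exponent to 2k - 1.
    c·n²ᵏ⁻¹≤Var = ℚₚ.≤-trans (subst₂ _≤ℚ_ left right
        (ℚₚ.*-monoˡ-≤-nonNeg g {{nonNegative 0≤g}} (*-mono-≤ 0≤γP (ℚₚ.≤-trans 0≤γP γP≤B) γP≤B γP≤B)))
      ½x²ν≤Var
      where
      P = fromℕ (n ℕ.^ k)
      g = ½ * (i! * i!) * (d q * d q) * ν
      0≤g : 0ℚ ≤ℚ g
      0≤g = 0≤* (0≤* (0≤* (ℚₚ.<⇒≤ (0<recip 1)) (0≤square i!)) (0≤square (d q))) 0≤ν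
      γP≤B : γ k * P ≤ℚ B
      γP≤B = γnᵏ≤binomial k (suc t)
      0≤γP : 0ℚ ≤ℚ γ k * P
      0≤γP = 0≤* (ℚₚ.<⇒≤ (0<γ k)) (0≤fromℕ (n ℕ.^ k))
      left : g * (γ k * P * (γ k * P)) ≡ c * fromℕ (n ℕ.^ (2 ℕ.* k ℕ.∸ 1))
      left = trans
        (solve 6 (λ h i d v g P → h :* (i :* i) :* (d :* d) :* v :* (g :* P :* (g :* P)) :=
          h :* (i :* i) :* (d :* d) :* (g :* g) :* (P :* P :* v)) refl ½ i! (d q) ν (γ k) P)
        (cong (c *_) power)
      right : g * (B * B) ≡ ½ * (x * x) * ν
      right = solve 5 (λ h i d v B → h :* (i :* i) :* (d :* d) :* v :* (B :* B) :=
        h :* (i :* (B :* d) :* (i :* (B :* d))) :* v) refl ½ i! (d q) ν B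

  bound : ∀ n → k < n → Var (X q n) ≥ℚ c * fromℕ (n ^ (2 *ℕ k ∸ 1))
  bound n k<n = subst (λ n → Var (X q n) ≥ℚ c * fromℕ (n ^ (2 *ℕ k ∸ 1)))
    (trans (ℕₚ.+-suc k (n ∸ suc k)) (ℕₚ.m+[n∸m]≡n k<n)) (c·n²ᵏ⁻¹≤Var (n ∸ suc k))

Var-bound : ∀ m (q : Permutation′ (2 ℕ.+ m)) → (∃ λ L → Weight.d L q ≢ 0ℚ) → let k = 2 ℕ.+ m in
  Σ[ c ∈ ℚ ] (0ℚ <ℚ c × (∀ (n : ℕ) → k < n → Var (X q n) ≥ℚ c * fromℕ (n ^ (2 *ℕ k ∸ 1))))
Var-bound m q (L , d≢0) = c , 0<c , bound
  where open LowerBound m L q d≢0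

proposition1 : ∀ (k : ℕ) → 2 ≤ k → (q : Permutation′ k) →
    Σ[ c ∈ ℚ ] (0ℚ <ℚ c × (∀ (n : ℕ) → k < n → Var (X q n) ≥ℚ c * fromℕ (n ^ (2 *ℕ k ∸ 1))))
-- A pattern of length 1 occurs exactly n times in every permutation, so its variance is 0 and no
-- positive constant would do.
proposition1 (suc zero)    (ℕ.s≤s ()) q
proposition1 (suc (suc m)) 2≤k        q =
  Var-bound m q (k ℕ.* (k ℕ.* k) , NonDegenerate.d≢0 m (k ℕ.* (k ℕ.* k)) refl q)
  where k = suc (suc m)
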